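{- Let $n$ be a positive integer and let $\Omega_1,\Omega_2$ be two distinct copies of $2^{[n]}$. For $i=1,2$ let $\bm{p}_i=(p_i^{(1)},\dots,p_i^{(n)})$ be a probability vector (i.e. $0<p_i^{(\ell)}<1$ for all $\ell$), write $p_i:=p_i^{(1)}$, and let $\mu_i$ be the product measure on $\Omega_i$ given by $$\mu_i(U)=\sum_{x\in U}\prod_{\ell\in x}p_i^{(\ell)}\prod_{k\in[n]\setminus x}(1-p_i^{(k)})\qquad (U\subset\Omega_i).$$ Assume that $p_1p_2=\max\{p_1^{(\ell)}p_2^{(\ell)}:\ell\in[n]\}$ and that $p_1^{(\ell)},p_2^{(\ell)}\leqslant 1/3$ for all $\ell\in[n]$. If $U_1\subset\Omega_1$ and $U_2\subset\Omega_2$ are cross-intersecting (i.e. $x\cap y\neq\emptyset$ for all $x\in U_1$, $y\in U_2$), then $\mu_1(U_1)\mu_2(U_2)\leqslant p_1p_2$. Moreover, with $w:=\{\ell\in[n]:p_1^{(\ell)}p_2^{(\ell)}=p_1p_2\}$ and $U_i^{(\ell)}:=\{x\in\Omega_i:\ell\in x\}$, equality holds if and only if $U_1=U_1^{(\ell)}$ and $U_2=U_2^{(\ell)}$ for some $\ell\in w$.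
   Context: A probability vector is a vector $\bm{p}=(p^{(1)},\dots,p^{(n)})$ with $0<p^{(\ell)}<1$ for every $\ell$. -}

module Defs where

open import Data.Bool.Base using (true; false)
open import Data.Fin.Base using (Fin)
open import Data.Fin.Subset using (Subset; _∈_; _∩_; ∁; Nonempty)
open import Data.Fin.Subset.Properties using (_∈?_)
import Data.Integer.Base as ℤ
open import Data.List.Base using (List; []; _∷_; _++_; map; filter; foldr; allFin)
open import Data.Nat.Base as ℕ using (ℕ; zero; suc)
import Data.Nat.Properties as ℕₚ
open import Data.Product.Base using (∃; _×_; _,_; proj₁; proj₂)
open import Data.Rational.Base as ℚ using (ℚ; 0ℚ; 1ℚ; ½)
import Data.Rational.Properties as ℚₚ
open import Data.Vec.Base using (Vec; []; _∷_)
open import Data.Vec.Functional using (Vector)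
open import Level using (0ℓ)
open import Relation.Binary.PropositionalEquality
  using (_≡_; refl; sym; trans; cong; cong₂; subst)
open import Relation.Unary using (Pred; Decidable)

-- The reals are Cauchy sequences of rationals with _≈_ as equality. In _<_ the
-- gap ε is uniform, so it is the order of the limits, not the eventual
-- pointwise one.

Eventually : Pred ℕ 0ℓ → Set
Eventually P = ∃ λ N → ∀ n → N ℕ.≤ n → P n

IsCauchy : (ℕ → ℚ) → Set
IsCauchy s = ∀ ε → 0ℚ ℚ.< ε →
  ∃ λ N → ∀ m n → N ℕ.≤ m → N ℕ.≤ n → ℚ.∣ s m ℚ.- s n ∣ ℚ.< ε

record ℝ : Set where
  constructor mkℝ
  field
    seq    : ℕ → ℚ
    cauchy : IsCauchy seq

open ℝ public

infix 4 _≈_ _<_ _≤_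

_≈_ : ℝ → ℝ → Set
x ≈ y = ∀ ε → 0ℚ ℚ.< ε → Eventually λ n → ℚ.∣ seq x n ℚ.- seq y n ∣ ℚ.< ε

_<_ : ℝ → ℝ → Set
x < y = ∃ λ ε → 0ℚ ℚ.< ε × Eventually λ n → seq x n ℚ.+ ε ℚ.< seq y n

_≤_ : ℝ → ℝ → Set
x ≤ y = ∀ ε → 0ℚ ℚ.< ε → Eventually λ n → seq x n ℚ.< seq y n ℚ.+ ε

module Cauchy where
  open import Algebra.Bundles using (CommutativeRing)
  open CommutativeRing ℚₚ.+-*-commutativeRing using (ring; +-group; +-commutativeSemigroup)
  open import Algebra.Properties.Ring ring using (x[y-z]≈xy-xz; [y-z]x≈yx-zx)
  open import Algebra.Properties.Group +-group using (//-rightDividesˡ)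
  open import Algebra.Properties.CommutativeSemigroup +-commutativeSemigroup
    using (interchange)

  telescope : ∀ a b c → (a ℚ.- b) ℚ.+ (b ℚ.- c) ≡ a ℚ.- c
  telescope a b c = trans (sym (ℚₚ.+-assoc (a ℚ.- b) b (ℚ.- c)))
                          (cong (ℚ._- c) (//-rightDividesˡ b a))

  +-difference : ∀ a b c d → (a ℚ.+ b) ℚ.- (c ℚ.+ d) ≡ (a ℚ.- c) ℚ.+ (b ℚ.- d)
  +-difference a b c d = trans (cong ((a ℚ.+ b) ℚ.+_) (ℚₚ.neg-distrib-+ c d))
                               (interchange a b (ℚ.- c) (ℚ.- d))

  *-difference : ∀ a b c d → a ℚ.* b ℚ.- c ℚ.* d ≡ a ℚ.* (b ℚ.- d) ℚ.+ (a ℚ.- c) ℚ.* d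
  *-difference a b c d = sym (trans
    (cong₂ ℚ._+_ (x[y-z]≈xy-xz a b d) ([y-z]x≈yx-zx d a c))
    (telescope (a ℚ.* b) (a ℚ.* d) (c ℚ.* d)))

  half+half : ∀ ε → ½ ℚ.* ε ℚ.+ ½ ℚ.* ε ≡ ε
  half+half ε = trans (sym (ℚₚ.*-distribʳ-+ ε ½ ½)) (ℚₚ.*-identityˡ ε)

  half-pos : ∀ {ε} → 0ℚ ℚ.< ε → 0ℚ ℚ.< ½ ℚ.* ε
  half-pos 0<ε = ℚₚ.*-monoʳ-<-pos ½ 0<ε

  const-cauchy : ∀ q → IsCauchy (λ _ → q)
  const-cauchy q ε 0<ε = 0 , λ _ _ _ _ →
    subst (λ d → ℚ.∣ d ∣ ℚ.< ε) (sym (ℚₚ.+-inverseʳ q)) 0<ε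

  +-cauchy : ∀ s t → IsCauchy s → IsCauchy t → IsCauchy (λ n → s n ℚ.+ t n)
  +-cauchy s t cs ct ε 0<ε
    with cs (½ ℚ.* ε) (half-pos 0<ε) | ct (½ ℚ.* ε) (half-pos 0<ε)
  ... | M , hs | N , ht = M ℕ.⊔ N , λ m n M⊔N≤m M⊔N≤n → begin-strict
    ℚ.∣ (s m ℚ.+ t m) ℚ.- (s n ℚ.+ t n) ∣
      ≡⟨ cong ℚ.∣_∣ (+-difference (s m) (t m) (s n) (t n)) ⟩
    ℚ.∣ (s m ℚ.- s n) ℚ.+ (t m ℚ.- t n) ∣
      ≤⟨ ℚₚ.∣p+q∣≤∣p∣+∣q∣ (s m ℚ.- s n) (t m ℚ.- t n) ⟩
    ℚ.∣ s m ℚ.- s n ∣ ℚ.+ ℚ.∣ t m ℚ.- t n ∣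
      <⟨ ℚₚ.+-mono-<
           (hs m n (ℕₚ.m⊔n≤o⇒m≤o M N M⊔N≤m) (ℕₚ.m⊔n≤o⇒m≤o M N M⊔N≤n))
           (ht m n (ℕₚ.m⊔n≤o⇒n≤o M N M⊔N≤m) (ℕₚ.m⊔n≤o⇒n≤o M N M⊔N≤n)) ⟩
    ½ ℚ.* ε ℚ.+ ½ ℚ.* ε
      ≡⟨ half+half ε ⟩
    ε ∎
    where open ℚₚ.≤-Reasoning

  neg-cauchy : ∀ s → IsCauchy s → IsCauchy (λ n → ℚ.- s n)
  neg-cauchy s cs ε 0<ε with cs ε 0<ε
  ... | N , hs = N , λ m n N≤m N≤n → subst (ℚ._< ε)
    (trans (sym (ℚₚ.∣-p∣≡∣p∣ (s m ℚ.- s n)))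
           (cong ℚ.∣_∣ (ℚₚ.neg-distrib-+ (s m) (ℚ.- s n))))
    (hs m n N≤m N≤n)

  bounded : ∀ s → IsCauchy s →
            ∃ λ B → ℚ.Positive B × Eventually λ n → ℚ.∣ s n ∣ ℚ.≤ B
  bounded s cs with cs 1ℚ (ℚₚ.positive⁻¹ 1ℚ)
  ... | N , hs = 1ℚ ℚ.+ ℚ.∣ s N ∣
    , ℚ.positive (ℚₚ.+-mono-<-≤ (ℚₚ.positive⁻¹ 1ℚ) (ℚₚ.0≤∣p∣ (s N)))
    , N , λ n N≤n → begin
      ℚ.∣ s n ∣
        ≡⟨ cong ℚ.∣_∣ (sym (//-rightDividesˡ (s N) (s n))) ⟩
      ℚ.∣ (s n ℚ.- s N) ℚ.+ s N ∣
        ≤⟨ ℚₚ.∣p+q∣≤∣p∣+∣q∣ (s n ℚ.- s N) (s N) ⟩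
      ℚ.∣ s n ℚ.- s N ∣ ℚ.+ ℚ.∣ s N ∣
        ≤⟨ ℚₚ.+-monoˡ-≤ ℚ.∣ s N ∣ (ℚₚ.<⇒≤ (hs n N N≤n ℕₚ.≤-refl)) ⟩
      1ℚ ℚ.+ ℚ.∣ s N ∣ ∎
    where open ℚₚ.≤-Reasoning

  shrink : ∀ B → ℚ.Positive B → ∀ ε → 0ℚ ℚ.< ε →
           ∃ λ δ → 0ℚ ℚ.< δ × B ℚ.* δ ≡ ½ ℚ.* ε
  shrink B B>0 ε 0<ε = B⁻¹ ℚ.* (½ ℚ.* ε) , 0<δ , eq
    where
    instance
      _ = B>0
      _ = ℚₚ.pos⇒nonZero B
    B⁻¹ = ℚ.1/ B
    0<δ : 0ℚ ℚ.< B⁻¹ ℚ.* (½ ℚ.* ε)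
    0<δ = subst (ℚ._< B⁻¹ ℚ.* (½ ℚ.* ε)) (ℚₚ.*-zeroʳ B⁻¹)
      (ℚₚ.*-monoʳ-<-pos B⁻¹ {{ℚₚ.1/pos⇒pos B}} (half-pos 0<ε))
    eq : B ℚ.* (B⁻¹ ℚ.* (½ ℚ.* ε)) ≡ ½ ℚ.* ε
    eq = trans (sym (ℚₚ.*-assoc B B⁻¹ (½ ℚ.* ε)))
      (trans (cong (ℚ._* (½ ℚ.* ε)) (ℚₚ.*-inverseʳ B)) (ℚₚ.*-identityˡ (½ ℚ.* ε)))

  ∣*∣-bound : ∀ a b {B δ} → ℚ.Positive B → ℚ.∣ a ∣ ℚ.≤ B → ℚ.∣ b ∣ ℚ.< δ →
              ℚ.∣ a ℚ.* b ∣ ℚ.< B ℚ.* δ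
  ∣*∣-bound a b {B} {δ} B>0 a≤B b<δ = begin-strict
    ℚ.∣ a ℚ.* b ∣
      ≡⟨ ℚₚ.∣p*q∣≡∣p∣*∣q∣ a b ⟩
    ℚ.∣ a ∣ ℚ.* ℚ.∣ b ∣
      ≤⟨ ℚₚ.*-monoʳ-≤-nonNeg ℚ.∣ b ∣ {{ℚ.nonNegative (ℚₚ.0≤∣p∣ b)}} a≤B ⟩
    B ℚ.* ℚ.∣ b ∣
      <⟨ ℚₚ.*-monoʳ-<-pos B {{B>0}} b<δ ⟩
    B ℚ.* δ ∎
    where open ℚₚ.≤-Reasoning

  *-cauchy : ∀ s t → IsCauchy s → IsCauchy t → IsCauchy (λ n → s n ℚ.* t n)
  *-cauchy s t cs ct ε 0<ε
    with bounded s cs | bounded t ct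
  ... | B , B>0 , K , hB | C , C>0 , L , hC
    with shrink B B>0 ε 0<ε | shrink C C>0 ε 0<ε
  ... | δ , 0<δ , Bδ≡ | γ , 0<γ , Cγ≡
    with cs γ 0<γ | ct δ 0<δ
  ... | M , hs | N , ht = (K ℕ.⊔ L) ℕ.⊔ (M ℕ.⊔ N) , λ m n R≤m R≤n → begin-strict
    ℚ.∣ s m ℚ.* t m ℚ.- s n ℚ.* t n ∣
      ≡⟨ cong ℚ.∣_∣ (*-difference (s m) (t m) (s n) (t n)) ⟩
    ℚ.∣ s m ℚ.* (t m ℚ.- t n) ℚ.+ (s m ℚ.- s n) ℚ.* t n ∣
      ≤⟨ ℚₚ.∣p+q∣≤∣p∣+∣q∣ (s m ℚ.* (t m ℚ.- t n)) ((s m ℚ.- s n) ℚ.* t n) ⟩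
    ℚ.∣ s m ℚ.* (t m ℚ.- t n) ∣ ℚ.+ ℚ.∣ (s m ℚ.- s n) ℚ.* t n ∣
      ≡⟨ cong (λ e → ℚ.∣ s m ℚ.* (t m ℚ.- t n) ∣ ℚ.+ ℚ.∣ e ∣) (ℚₚ.*-comm (s m ℚ.- s n) (t n)) ⟩
    ℚ.∣ s m ℚ.* (t m ℚ.- t n) ∣ ℚ.+ ℚ.∣ t n ℚ.* (s m ℚ.- s n) ∣
      <⟨ ℚₚ.+-mono-<
           (∣*∣-bound (s m) (t m ℚ.- t n) B>0 (hB m (K≤ R≤m)) (ht m n (N≤ R≤m) (N≤ R≤n)))
           (∣*∣-bound (t n) (s m ℚ.- s n) C>0 (hC n (L≤ R≤n)) (hs m n (M≤ R≤m) (M≤ R≤n))) ⟩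
    B ℚ.* δ ℚ.+ C ℚ.* γ
      ≡⟨ cong₂ ℚ._+_ Bδ≡ Cγ≡ ⟩
    ½ ℚ.* ε ℚ.+ ½ ℚ.* ε
      ≡⟨ half+half ε ⟩
    ε ∎
    where
    open ℚₚ.≤-Reasoning
    K≤ : ∀ {m} → (K ℕ.⊔ L) ℕ.⊔ (M ℕ.⊔ N) ℕ.≤ m → K ℕ.≤ m
    K≤ h = ℕₚ.m⊔n≤o⇒m≤o K L (ℕₚ.m⊔n≤o⇒m≤o (K ℕ.⊔ L) (M ℕ.⊔ N) h)
    L≤ : ∀ {m} → (K ℕ.⊔ L) ℕ.⊔ (M ℕ.⊔ N) ℕ.≤ m → L ℕ.≤ m
    L≤ h = ℕₚ.m⊔n≤o⇒n≤o K L (ℕₚ.m⊔n≤o⇒m≤o (K ℕ.⊔ L) (M ℕ.⊔ N) h)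
    M≤ : ∀ {m} → (K ℕ.⊔ L) ℕ.⊔ (M ℕ.⊔ N) ℕ.≤ m → M ℕ.≤ m
    M≤ h = ℕₚ.m⊔n≤o⇒m≤o M N (ℕₚ.m⊔n≤o⇒n≤o (K ℕ.⊔ L) (M ℕ.⊔ N) h)
    N≤ : ∀ {m} → (K ℕ.⊔ L) ℕ.⊔ (M ℕ.⊔ N) ℕ.≤ m → N ℕ.≤ m
    N≤ h = ℕₚ.m⊔n≤o⇒n≤o M N (ℕₚ.m⊔n≤o⇒n≤o (K ℕ.⊔ L) (M ℕ.⊔ N) h)

open Cauchy

infixl 7 _*_
infixl 6 _+_ _-_
infix  8 -_

fromℚ : ℚ → ℝ
fromℚ q = mkℝ (λ _ → q) (const-cauchy q)

0ℝ 1ℝ ⅓ : ℝ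
0ℝ = fromℚ 0ℚ
1ℝ = fromℚ 1ℚ
⅓  = fromℚ (ℤ.+ 1 ℚ./ 3)

_+_ : ℝ → ℝ → ℝ
x + y = mkℝ (λ n → seq x n ℚ.+ seq y n) (+-cauchy (seq x) (seq y) (cauchy x) (cauchy y))

_*_ : ℝ → ℝ → ℝ
x * y = mkℝ (λ n → seq x n ℚ.* seq y n) (*-cauchy (seq x) (seq y) (cauchy x) (cauchy y))

-_ : ℝ → ℝ
- x = mkℝ (λ n → ℚ.- seq x n) (neg-cauchy (seq x) (cauchy x))

_-_ : ℝ → ℝ → ℝ
x - y = x + (- y)

∑ ∏ : {A : Set} → List A → (A → ℝ) → ℝ
∑ xs f = foldr (λ a s → f a + s) 0ℝ xs
∏ xs f = foldr (λ a s → f a * s) 1ℝ xs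

infix 5 ∑ ∏
syntax ∑ xs (λ x → e) = ∑[ x ← xs ] e
syntax ∏ xs (λ x → e) = ∏[ x ← xs ] e

IsMaximum : {A : Set} → ℝ → (A → ℝ) → Set
IsMaximum a f = (∃ λ i → f i ≈ a) × (∀ i → f i ≤ a)

allSubsets : ∀ n → List (Subset n)
allSubsets zero    = [] ∷ []
allSubsets (suc n) = map (true ∷_) (allSubsets n) ++ map (false ∷_) (allSubsets n)

elements : ∀ {n} → Subset n → List (Fin n)
elements x = filter (_∈? x) (allFin _)

IsProbabilityVector : ∀ {n} → Vector ℝ n → Set
IsProbabilityVector p = ∀ ℓ → 0ℝ < p ℓ × p ℓ < 1ℝ

-- Decidability of U is what makes the sum over its members computable;
-- classically every family of subsets of [n] is decidable.
μ : ∀ {n} → Vector ℝ n → {U : Pred (Subset n) 0ℓ} → Decidable U → ℝ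
μ {n} p U? =
  ∑[ x ← filter U? (allSubsets n) ]
    ((∏[ ℓ ← elements x ] p ℓ) * (∏[ k ← elements (∁ x) ] (1ℝ - p k)))

CrossIntersecting : ∀ {n} → Pred (Subset n) 0ℓ → Pred (Subset n) 0ℓ → Set
CrossIntersecting U₁ U₂ = ∀ x y → U₁ x → U₂ y → Nonempty (x ∩ y)

star : ∀ {n} → Fin n → Pred (Subset n) 0ℓ
star ℓ x = ℓ ∈ x

{-# OPTIONS --safe #-}

-- Induction on n. Splitting U₁ and U₂ on one coordinate gives, for each family,
-- the section without it and the shadow (the union of both sections); the
-- section of one family and the shadow of the other are cross-intersecting.
-- With P = p₁ p₂ ≤ 1/9 the induction carries two bounds on the measures u, v:
-- the Hoffman-type bound uv ≤ Λ (1 − u)(1 − v), which is inductive by itself,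
-- and uv ≤ P, whose induction step needs both. If the shadows have measures
-- x₁, y₁ with x₁ y₁ ≤ 2/5, then uv ≤ P for the new measures follows from the
-- same bound for the smaller families; otherwise both shadows are large, the
-- Hoffman-type bound forces the sections to be small, and
-- uv ≤ P − c (2 − x₁ − y₁). Equality in either case makes the coordinate
-- irrelevant or makes both families its star.
module Submission where

open import Defs using (allSubsets; elements)

open import Algebra.Bundles using (CommutativeRing)
open import Algebra.Structures using (IsCommutativeRing)
import Algebra.Properties.CommutativeSemigroup as CommutativeSemigroupProperties
import Algebra.Properties.Ring as RingProperties
import Algebra.Solver.Ring as RingSolver
open import Algebra.Solver.Ring.AlmostCommutativeRing
  using (fromCommutativeRing; _-Raw-AlmostCommutative⟶_)
open import Data.Bool.Base using (Bool; true; false; _∨_; if_then_else_)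
import Data.Bool.Properties as Bool
open import Data.Fin.Base using (Fin; zero; suc)
open import Data.Fin.Patterns using (0F; 1F; 2F; 3F; 4F; 5F; 6F)
open import Data.Fin.Properties using (any?)
open import Data.Fin.Subset using (Subset; Nonempty; _∩_; ∁; ⁅_⁆)
open import Data.Fin.Subset.Properties using (_∈?_; anySubset?; x∈⁅x⁆; x∈⁅y⁆⇒x≡y)
open import Data.Integer.Base as ℤ using (ℤ; +_)
import Data.Integer.Properties as ℤₚ
open import Data.List.Base as List using (List; []; _∷_; _++_; filter; foldr; allFin)
open import Data.List.Properties using (map-tabulate; filter-++)
import Data.Maybe.Base as Maybe
open import Data.Nat.Base as ℕ using (ℕ; zero; suc)
import Data.Nat.Coprimality as Coprimality
import Data.Nat.Properties as ℕₚ
open import Data.Product.Base using (∃; _×_; _,_; proj₁; proj₂)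
open import Data.Rational.Base as ℚ using (ℚ; 0ℚ; 1ℚ; ½)
import Data.Rational.Properties as ℚₚ
import Data.Rational.Solver as ℚ-Solver
open import Data.Sum.Base using (_⊎_; inj₁; inj₂)
open import Data.Vec.Base using (Vec; []; _∷_; lookup; there)
open import Data.Vec.Functional using (Vector)
open import Data.Vec.Properties using ([]=⇒lookup; lookup⇒[]=)
open import Function.Base using (_∘_; const)
open import Function.Bundles using (_⇔_; mk⇔)
open import Level using (0ℓ)
open import Relation.Binary.Consequences using (dec⇒weaklyDec)
open import Relation.Binary.PropositionalEquality
  using (_≡_; refl; cong; cong₂; sym; trans; subst; subst₂)
open import Relation.Nullary.Decidable
  using (Dec; yes; no; does; map′; ¬?; _×-dec_; decidable-stable; dec-true)
open import Relation.Nullary.Negation using (¬_; Stable; negated-stable; contradiction)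
open import Relation.Unary using (Pred; Decidable; _≐_)

-- Ordered rings and polynomial certificates.

-- A ring with the cone of non-negative elements of a linear order. Totality is
-- only assumed up to double negation, as this is what holds for Cauchy reals.
record OrderedRing : Set₁ where
  field
    commutativeRing : CommutativeRing 0ℓ 0ℓ
  open CommutativeRing commutativeRing public
    using (Carrier; _≈_; _+_; _*_; -_; _-_)
  field
    morphism    : CommutativeRing.rawRing ℤₚ.+-*-commutativeRing
                    -Raw-AlmostCommutative⟶ fromCommutativeRing commutativeRing
  open _-Raw-AlmostCommutative⟶_ morphism public using () renaming (⟦_⟧ to ι)
  field
    NonNeg      : Carrier → Set
    nonNeg-resp : ∀ {x y} → x ≈ y → NonNeg x → NonNeg y
    nonNeg-+    : ∀ {x y} → NonNeg x → NonNeg y → NonNeg (x + y)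
    nonNeg-*    : ∀ {x y} → NonNeg x → NonNeg y → NonNeg (x * y)
    nonNeg-ι    : ∀ n → NonNeg (ι (+ n))
    stable      : ∀ {x} → Stable (NonNeg x)
    total       : ∀ x → ¬ ¬ (NonNeg x ⊎ NonNeg (- x))

  -- The refutation of `0 ≤ - x`, not a positive lower bound: `cancel` asks for this much only.
  Pos : Carrier → Set
  Pos x = ¬ NonNeg (- x)

  field
    pos-ι       : ∀ n → Pos (ι (+ suc n))
    cancel      : ∀ {c x} → Pos c → NonNeg (c * x) → NonNeg x

-- An inequality 0 ≤ t is proved by exhibiting a polynomial built from
-- non-negative ones by sums and products and with the normal form of t.
module Certificates (R : OrderedRing) where
  open OrderedRing R
  private module R = CommutativeRing commutativeRing
  open RingProperties R.ring using (-‿distribʳ-*)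

  open RingSolver (CommutativeRing.rawRing ℤₚ.+-*-commutativeRing)
    (fromCommutativeRing commutativeRing) morphism
    (λ i j → Maybe.map (λ i≡j → R.reflexive (cong ι i≡j)) (dec⇒weaklyDec ℤₚ._≟_ i j))
    public using (Polynomial; con; var; _:+_; _:*_; _:-_; :-_; ⟦_⟧; ⟦_⟧↓; prove)

  # : ∀ {n} → ℕ → Polynomial n
  # k = con (+ k)

  pos-* : ∀ {c d} → Pos c → Pos d → Pos (c * d)
  pos-* {c} {d} c>0 d>0 cd≤0 = d>0 (cancel c>0 (nonNeg-resp (-‿distribʳ-* c d) cd≤0))

  module At {n} (ρ : Vec Carrier n) where
    infix  4 0≤_ 0<_
    infixl 6 _⊕_
    infixl 7 _⊗_

    -- A record rather than a function into `NonNeg`, so that unification recovers the polynomial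
    -- from the type of a proof.
    record 0≤_ (e : Polynomial n) : Set where
      constructor [_]
      field holds : NonNeg (⟦ e ⟧ ρ)
    open 0≤_ public

    given : ∀ e → NonNeg (⟦ e ⟧ ρ) → 0≤ e
    given _ h = [ h ]

    0<_ : Polynomial n → Set
    0< e = Pos (⟦ e ⟧ ρ)

    _⊕_ : ∀ {e f} → 0≤ e → 0≤ f → 0≤ e :+ f
    [ h ] ⊕ [ k ] = [ nonNeg-+ h k ]

    _⊗_ : ∀ {e f} → 0≤ e → 0≤ f → 0≤ e :* f
    [ h ] ⊗ [ k ] = [ nonNeg-* h k ]

    lit : ∀ k → 0≤ # k
    lit k = [ nonNeg-ι k ]

    by : ∀ {e} t → 0≤ e → ⟦ e ⟧↓ ρ ≈ ⟦ t ⟧↓ ρ → 0≤ t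
    by {e} t [ h ] eq = [ nonNeg-resp (prove ρ e t eq) h ]

    divide : ∀ {e} c → 0< c → 0≤ c :* e → 0≤ e
    divide _ c>0 [ h ] = [ cancel c>0 h ]

    -- Totality holds only up to double negation, so a case distinction is available for stable
    -- goals.
    cases : ∀ {A : Set} e → Stable A → (0≤ e → A) → (0≤ :- e → A) → A
    cases e A-stable pos neg = A-stable λ ¬A → total (⟦ e ⟧ ρ) λ
      { (inj₁ h) → ¬A (pos [ h ]) ; (inj₂ h) → ¬A (neg [ h ]) }

    0≤-stable : ∀ {e} → Stable (0≤ e)
    0≤-stable ¬¬h = [ stable (λ ¬h → ¬¬h (¬h ∘ holds)) ]

    square : ∀ e → 0≤ e :* e
    square e = cases e 0≤-stable (λ h → h ⊗ h)
      -- `(- e)(- e) = e e`, with the value of `e` as a single variable: `e` is not concrete here,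
      -- so its own normal form does not compute.
      (λ h → [ nonNeg-resp
        (prove (⟦ e ⟧ ρ ∷ []) (:- var 0F :* :- var 0F) (var 0F :* var 0F) R.refl)
        (holds (h ⊗ h)) ])

  module Eq = R

-- The region of measure pairs and the step for one coordinate.

-- The pairs of measures (x, y) in the region cut out by x y ≤ P and H ≥ 0 will
-- contain those of cross-intersecting families. H ≥ 0 is the Hoffman-type bound
--   x y ≤ Λ (1 − x) (1 − y),  Λ = 3P / (2 − 6P),
-- where Λ is the largest product of odds that P = a b and a, b ≤ 1/3 allow.
module Region (R : OrderedRing) where
  open OrderedRing R
  open Certificates R

  -- The bound above multiplied by `2 - 6P`, with the terms in `x y` collected. It is affine in `x`
  -- and in `y`.
  hoffmanᵖ : ∀ {n} → Polynomial n → Polynomial n → Polynomial n → Polynomial n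
  hoffmanᵖ p x y = # 3 :* p :* (# 1 :- x :- y) :- (# 2 :- # 9 :* p) :* x :* y

  hoffman : Carrier → Carrier → Carrier → Carrier
  hoffman P x y = ⟦ hoffmanᵖ (var 0F) (var 1F) (var 2F) ⟧ (P ∷ x ∷ y ∷ [])

  module _ {P u v u′ v′ : Carrier} where
    private
      ρ : Vec Carrier 5
      ρ = P ∷ u ∷ v ∷ u′ ∷ v′ ∷ []
      open At ρ
      p x y x′ y′ : Polynomial 5
      p = var 0F
      x = var 1F
      y = var 2F
      x′ = var 3F
      y′ = var 4F
      H : Polynomial 5 → Polynomial 5 → Polynomial 5
      H = hoffmanᵖ p

    module _ (v≥0 : NonNeg v) (u′≥0 : NonNeg u′)
             (u′≤u : NonNeg (u - u′)) (v′≤v : NonNeg (v - v′)) where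
      private
        gap-x : 0≤ x :- x′
        gap-x = [ u′≤u ]
        gap-y : 0≤ y :- y′
        gap-y = [ v′≤v ]
        0≤y : 0≤ y
        0≤y = [ v≥0 ]
        0≤x′ : 0≤ x′
        0≤x′ = [ u′≥0 ]

      -- The slopes `-(3P + (2 - 9P) y)` and `-(3P + (2 - 9P) x)` are not positive once `9P ≤ 1`.
      -- The path goes from `x` to `x′` at height `y`, then from `y` to `y′` at `x′`.
      hoffman-antitone : NonNeg P → NonNeg (ι (+ 1) - ι (+ 9) * P) →
        NonNeg (hoffman P u v) → NonNeg (hoffman P u′ v′)
      hoffman-antitone P≥0 9P≤1 h = holds (by (H x′ y′)
        (hxy ⊕ gap-x ⊗ (lit 3 ⊗ 0≤p ⊕ (lit 1 ⊕ 9p≤1) ⊗ 0≤y)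
             ⊕ gap-y ⊗ (lit 3 ⊗ 0≤p ⊕ (lit 1 ⊕ 9p≤1) ⊗ 0≤x′)) Eq.refl)
        where
        0≤p : 0≤ p
        0≤p = [ P≥0 ]
        9p≤1 : 0≤ # 1 :- # 9 :* p
        9p≤1 = [ 9P≤1 ]
        hxy : 0≤ H x y
        hxy = [ h ]

      product-monotone : NonNeg (u * v - u′ * v′)
      product-monotone =
        holds (by (x :* y :- x′ :* y′) (gap-x ⊗ 0≤y ⊕ 0≤x′ ⊗ gap-y) Eq.refl)

  -- When x₁ y₁ is large, the product is bounded by its value at the end point
  -- (a, b) = (1/3, 3P), selected by y₀ (x₁ − x₀) ≥ x₀ (y₁ − y₀). Three times
  -- this value is F. With α = 1 − x₁ and β = 1 − y₁, the bound F ≥ 3P makes αβ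
  -- large compared with α + β, while x₁ y₁ ≥ 2/5 makes it small.
  module LargeCorner {P a b x₀ x₁ y₀ y₁ : Carrier} where
    private
      ρ : Vec Carrier 7
      ρ = P ∷ a ∷ b ∷ x₀ ∷ x₁ ∷ y₀ ∷ y₁ ∷ []
    open At ρ public
    private
      p A B X₀ X₁ Y₀ Y₁ α β U V : Polynomial 7
      p  = var 0F
      A  = var 1F
      B  = var 2F
      X₀ = var 3F
      X₁ = var 4F
      Y₀ = var 5F
      Y₁ = var 6F
      α  = # 1 :- X₁
      β  = # 1 :- Y₁
      U  = (# 1 :- A) :* X₀ :+ A :* X₁
      V  = (# 1 :- B) :* Y₀ :+ B :* Y₁
      H : Polynomial 7 → Polynomial 7 → Polynomial 7
      H = hoffmanᵖ p
      F : Polynomial 7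
      F = (# 2 :* X₀ :+ X₁) :* ((# 1 :- # 3 :* p) :* Y₀ :+ # 3 :* p :* Y₁)

    corner-dictates :
      0< p → 0≤ p → 0≤ # 1 :- # 9 :* p →
      0≤ # 1 :- # 3 :* A → 0≤ # 1 :- # 3 :* B → 0≤ p :- A :* B →
      0≤ X₀ → 0≤ X₁ :- X₀ → 0≤ α → 0≤ Y₀ → 0≤ Y₁ :- Y₀ → 0≤ β →
      0≤ H X₀ Y₁ → 0≤ H X₁ Y₀ →
      0≤ Y₀ :* (X₁ :- X₀) :- X₀ :* (Y₁ :- Y₀) →
      0≤ # 5 :* (X₁ :* Y₁) :- # 2 →
      0≤ U :* V :- p →
      0≤ :- α :- β
    corner-dictates 0<p 0≤p 9p≤1 3A≤1 3B≤1 AB≤p 0≤X₀ ΔX 0≤α 0≤Y₀ ΔY 0≤β H₀₁ H₁₀ side z≥ UV≥p =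
      -- The factors 14 and 9 cancel `α β` and leave `(- 28 + 27)(α + β)`.
      by (:- α :- β) (lit 14 ⊗ αβ≥ ⊕ lit 9 ⊗ αβ≤) Eq.refl
      where
      0≤X₁ : 0≤ X₁
      0≤X₁ = by X₁ (0≤X₀ ⊕ ΔX) Eq.refl
      0≤Y₁ : 0≤ Y₁
      0≤Y₁ = by Y₁ (0≤Y₀ ⊕ ΔY) Eq.refl
      0<3p : 0< # 3 :* p
      0<3p = pos-* (pos-ι 2) 0<p
      3p≤1 : 0≤ # 1 :- # 3 :* p
      3p≤1 = by (# 1 :- # 3 :* p) (9p≤1 ⊕ lit 6 ⊗ 0≤p) Eq.refl
      X₁≥ : 0≤ # 5 :* X₁ :- # 2
      X₁≥ = by (# 5 :* X₁ :- # 2) (z≥ ⊕ lit 5 ⊗ 0≤X₁ ⊗ 0≤β) Eq.refl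
      Y₁≥ : 0≤ # 5 :* Y₁ :- # 2
      Y₁≥ = by (# 5 :* Y₁ :- # 2) (z≥ ⊕ lit 5 ⊗ 0≤Y₁ ⊗ 0≤α) Eq.refl
      -- In `F - 3 U V` the coefficient `9p - 3B` of `X₀ (Y₁ - Y₀)` may be negative. `side` moves
      -- the weight `1 - 3A` there, and the sum is `9 (p - A B) + (1 - 3A)(1 - 3B)`.
      F≥3p : 0≤ F :- # 3 :* p
      F≥3p = by (F :- # 3 :* p)
        (lit 3 ⊗ UV≥p ⊕ 3A≤1 ⊗ side ⊕ (lit 9 ⊗ AB≤p ⊕ 3A≤1 ⊗ 3B≤1) ⊗ 0≤X₀ ⊗ ΔY
          ⊕ lit 3 ⊗ AB≤p ⊗ ΔX ⊗ ΔY) Eq.refl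
      4X₀Y₁≤β : 0≤ β :- # 4 :* X₀ :* Y₁
      4X₀Y₁≤β = divide (# 3 :* p) 0<3p (by (# 3 :* p :* (β :- # 4 :* X₀ :* Y₁))
        (H₀₁ ⊕ 0≤X₀ ⊗ (lit 2 ⊗ 9p≤1 ⊗ 0≤Y₁ ⊕ lit 3 ⊗ 0≤p ⊗ 0≤β)) Eq.refl)
      -- The Hoffman-type bound at `(X₁, Y₀)` with the factor `1 - Y₀` replaced by 1.
      X₁Y₀≤α : 0≤ # 3 :* p :* α :- # 2 :* (# 1 :- # 3 :* p) :* X₁ :* Y₀
      X₁Y₀≤α = by (# 3 :* p :* α :- # 2 :* (# 1 :- # 3 :* p) :* X₁ :* Y₀)
        (H₁₀ ⊕ lit 3 ⊗ 0≤p ⊗ 0≤Y₀ ⊗ 0≤α) Eq.refl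
      2X₀≤β : 0≤ β :- # 2 :* X₀
      2X₀≤β = divide (# 15 :* (# 3 :* p)) (pos-* (pos-ι 14) 0<3p)
        (by (# 15 :* (# 3 :* p) :* (β :- # 2 :* X₀))
          (lit 15 ⊗ H₀₁ ⊕ 0≤X₀ ⊗ (lit 15 ⊗ 9p≤1 ⊗ 0≤Y₁ ⊕ lit 3 ⊗ Y₁≥ ⊕ lit 5 ⊗ 9p≤1 ⊕ lit 1))
          Eq.refl)
      -- `2X₀≤β` combined with `X₀` times `X₁Y₀≤α`, after which `X₁ ≥ 2/5` removes `X₁`.
      X₀Y₀≤αβ : 0≤ # 15 :* p :* α :* β :- # 8 :* (# 1 :- # 3 :* p) :* X₀ :* Y₀
      X₀Y₀≤αβ = by (# 15 :* p :* α :* β :- # 8 :* (# 1 :- # 3 :* p) :* X₀ :* Y₀)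
        (lit 15 ⊗ 0≤p ⊗ 0≤α ⊗ 2X₀≤β ⊕ lit 10 ⊗ 0≤X₀ ⊗ X₁Y₀≤α
          ⊕ lit 4 ⊗ 3p≤1 ⊗ 0≤X₀ ⊗ 0≤Y₀ ⊗ X₁≥) Eq.refl
      -- Of the four terms of `F`, those with `X₀` or `Y₀` have been bounded above; the last is
      -- `3p X₁ Y₁ = 3p (1 - α)(1 - β)`.
      αβ≥ : 0≤ # 9 :* α :* β :- # 2 :* (α :+ β)
      αβ≥ = divide (# 3 :* p) 0<3p (by (# 3 :* p :* (# 9 :* α :* β :- # 2 :* (α :+ β)))
        (lit 4 ⊗ F≥3p ⊕ X₀Y₀≤αβ ⊕ lit 6 ⊗ 0≤p ⊗ 4X₀Y₁≤β ⊕ lit 2 ⊗ X₁Y₀≤α) Eq.refl)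
      αβ≤ : 0≤ # 3 :* (α :+ β) :- # 14 :* α :* β
      αβ≤ = by (# 3 :* (α :+ β) :- # 14 :* α :* β)
        ((0≤α ⊕ 0≤β) ⊗ z≥ ⊕ lit 5 ⊗ square (α :- β) ⊕ 0≤α ⊗ 0≤β ⊗ (X₁≥ ⊕ Y₁≥)) Eq.refl

  -- One coordinate, of weights a and b: u and v average the measures of the
  -- two sections, and only (x₀, y₁) and (x₁, y₀) are known to be in the region.
  module Step {P a b x₀ x₁ y₀ y₁ : Carrier}
    (P>0 : Pos P) (P≥0 : NonNeg P) (9P≤1 : NonNeg (ι (+ 1) - ι (+ 9) * P))
    (a≥0 : NonNeg a) (3a≤1 : NonNeg (ι (+ 1) - ι (+ 3) * a))
    (b≥0 : NonNeg b) (3b≤1 : NonNeg (ι (+ 1) - ι (+ 3) * b))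
    (ab≤P : NonNeg (P - a * b))
    (x₀≥0 : NonNeg x₀) (x₀≤x₁ : NonNeg (x₁ - x₀)) (x₁≤1 : NonNeg (ι (+ 1) - x₁))
    (y₀≥0 : NonNeg y₀) (y₀≤y₁ : NonNeg (y₁ - y₀)) (y₁≤1 : NonNeg (ι (+ 1) - y₁))
    (x₀y₁≤P : NonNeg (P - x₀ * y₁)) (h₀₁ : NonNeg (hoffman P x₀ y₁))
    (x₁y₀≤P : NonNeg (P - x₁ * y₀)) (h₁₀ : NonNeg (hoffman P x₁ y₀))
    where
    private
      ρ : Vec Carrier 7
      ρ = P ∷ a ∷ b ∷ x₀ ∷ x₁ ∷ y₀ ∷ y₁ ∷ []
      open At ρ
      p A B X₀ X₁ Y₀ Y₁ U V Z : Polynomial 7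
      p  = var 0F
      A  = var 1F
      B  = var 2F
      X₀ = var 3F
      X₁ = var 4F
      Y₀ = var 5F
      Y₁ = var 6F
      U  = (# 1 :- A) :* X₀ :+ A :* X₁
      V  = (# 1 :- B) :* Y₀ :+ B :* Y₁
      Z  = X₁ :* Y₁
      H : Polynomial 7 → Polynomial 7 → Polynomial 7
      H = hoffmanᵖ p

      0≤p : 0≤ p
      0≤p = [ P≥0 ]
      9p≤1 : 0≤ # 1 :- # 9 :* p
      9p≤1 = [ 9P≤1 ]
      0≤A : 0≤ A
      0≤A = [ a≥0 ]
      3A≤1 : 0≤ # 1 :- # 3 :* A
      3A≤1 = [ 3a≤1 ]
      0≤B : 0≤ B
      0≤B = [ b≥0 ]
      3B≤1 : 0≤ # 1 :- # 3 :* B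
      3B≤1 = [ 3b≤1 ]
      AB≤p : 0≤ p :- A :* B
      AB≤p = [ ab≤P ]
      0≤X₀ : 0≤ X₀
      0≤X₀ = [ x₀≥0 ]
      ΔX : 0≤ X₁ :- X₀
      ΔX = [ x₀≤x₁ ]
      0≤α : 0≤ # 1 :- X₁
      0≤α = [ x₁≤1 ]
      0≤Y₀ : 0≤ Y₀
      0≤Y₀ = [ y₀≥0 ]
      ΔY : 0≤ Y₁ :- Y₀
      ΔY = [ y₀≤y₁ ]
      0≤β : 0≤ # 1 :- Y₁
      0≤β = [ y₁≤1 ]
      Q₀₁ : 0≤ p :- X₀ :* Y₁
      Q₀₁ = [ x₀y₁≤P ]
      H₀₁ : 0≤ H X₀ Y₁
      H₀₁ = [ h₀₁ ]
      Q₁₀ : 0≤ p :- X₁ :* Y₀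
      Q₁₀ = [ x₁y₀≤P ]
      H₁₀ : 0≤ H X₁ Y₀
      H₁₀ = [ h₁₀ ]

      A≤1 : 0≤ # 1 :- A
      A≤1 = by (# 1 :- A) (3A≤1 ⊕ lit 2 ⊗ 0≤A) Eq.refl
      B≤1 : 0≤ # 1 :- B
      B≤1 = by (# 1 :- B) (3B≤1 ⊕ lit 2 ⊗ 0≤B) Eq.refl
      A+B≤1 : 0≤ # 1 :- A :- B
      A+B≤1 = divide (# 3) (pos-ι 2)
        (by (# 3 :* (# 1 :- A :- B)) (3A≤1 ⊕ 3B≤1 ⊕ lit 1) Eq.refl)
      0≤X₁ : 0≤ X₁
      0≤X₁ = by X₁ (0≤X₀ ⊕ ΔX) Eq.refl
      0≤Y₁ : 0≤ Y₁
      0≤Y₁ = by Y₁ (0≤Y₀ ⊕ ΔY) Eq.refl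
      0≤U : 0≤ U
      0≤U = A≤1 ⊗ 0≤X₀ ⊕ 0≤A ⊗ 0≤X₁
      0≤V : 0≤ V
      0≤V = B≤1 ⊗ 0≤Y₀ ⊕ 0≤B ⊗ 0≤Y₁
      U≤X₁ : 0≤ X₁ :- U
      U≤X₁ = by (X₁ :- U) (A≤1 ⊗ ΔX) Eq.refl
      V≤Y₁ : 0≤ Y₁ :- V
      V≤Y₁ = by (Y₁ :- V) (B≤1 ⊗ ΔY) Eq.refl
      0<2p : 0< # 2 :* p
      0<2p = pos-* (pos-ι 1) P>0
      0<3p : 0< # 3 :* p
      0<3p = pos-* (pos-ι 2) P>0

    u v : Carrier
    u = ⟦ U ⟧ ρ
    v = ⟦ V ⟧ ρ

    -- Couple the two sides with weight `1 - A - B` on `(x₀, y₀)`, `A` on `(x₁, y₀)` and `B` on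
    -- `(x₀, y₁)`. As `H` is affine in each argument, the product weights differ from this only by
    -- adding `A B (x₁ - x₀)(y₁ - y₀)` to the mean of `x y`. The excess of `H(x₀, y₀)` over
    -- `H(x₀, y₁)` pays for it, because `H(A, B) = 2 (p - A B) + p (1 - 3A)(1 - 3B) ≥ 0`.
    hoffman-step : NonNeg (hoffman P u v)
    hoffman-step = holds (by (H U V)
      (A+B≤1 ⊗ H₀₁ ⊕ 0≤A ⊗ H₁₀ ⊕ 0≤B ⊗ H₀₁ ⊕ A+B≤1 ⊗ 2-9p ⊗ 0≤X₀ ⊗ ΔY
        ⊕ (lit 2 ⊗ AB≤p ⊕ 0≤p ⊗ 3A≤1 ⊗ 3B≤1) ⊗ ΔY
        ⊕ 2-9p ⊗ 0≤A ⊗ 0≤B ⊗ ΔY ⊗ (0≤α ⊕ 0≤X₀)) Eq.refl)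
      where
      2-9p : 0≤ # 1 :+ (# 1 :- # 9 :* p)
      2-9p = lit 1 ⊕ 9p≤1

    private
      module _ (UV≥p : 0≤ U :* V :- p) where
        p≤Z : 0≤ Z :- p
        p≤Z = by (Z :- p) (U≤X₁ ⊗ 0≤Y₁ ⊕ 0≤U ⊗ V≤Y₁ ⊕ UV≥p) Eq.refl

        -- Here `P ≤ U V ≤ Z ≤ P`. Lowering `X₁` to `U` costs `(1 - A)(X₁ - X₀) Y₁`, which is at
        -- least `2/3 P (X₁ - X₀)` since `Y₁ ≥ Z ≥ P`; hence `X₁ = X₀`. The other side is symmetric.
        flat : 0≤ p :- Z → 0≤ X₀ :- X₁ × 0≤ Y₀ :- Y₁
        flat Z≤p =
            divide (# 2 :* p) 0<2p (by (# 2 :* p :* (X₀ :- X₁))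
              (lit 3 ⊗ Z≤p ⊕ lit 3 ⊗ UV≥p ⊕ lit 3 ⊗ 0≤U ⊗ V≤Y₁
                ⊕ ΔX ⊗ (3A≤1 ⊗ 0≤Y₁ ⊕ lit 2 ⊗ (0≤Y₁ ⊗ 0≤α ⊕ p≤Z))) Eq.refl)
          , divide (# 2 :* p) 0<2p (by (# 2 :* p :* (Y₀ :- Y₁))
              (lit 3 ⊗ Z≤p ⊕ lit 3 ⊗ UV≥p ⊕ lit 3 ⊗ U≤X₁ ⊗ 0≤V
                ⊕ ΔY ⊗ (3B≤1 ⊗ 0≤X₁ ⊕ lit 2 ⊗ (0≤X₁ ⊗ 0≤β ⊕ p≤Z))) Eq.refl)

        -- Multiplied by Z, the product U V is at most
        -- ((1 − A) p + A Z) ((1 − B) p + B Z), and this exceeds p Z by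
        -- − (Z − p) ((1 − A) (1 − B) p − A B Z).
        medium : 0≤ # 2 :- # 5 :* Z → 0≤ p :- Z
        medium Z≤ = divide (# 2 :* p) 0<2p (by (# 2 :* p :* (p :- Z))
          (lit 45 ⊗ excess ⊕ p≤Z ⊗ K≥) Eq.refl)
          where
          K : Polynomial 7
          K = (# 1 :- A) :* (# 1 :- B) :* p :- A :* B :* Z
          excess : 0≤ (p :- Z) :* K
          excess = by ((p :- Z) :* K)
            (0≤X₁ ⊗ 0≤Y₁ ⊗ UV≥p ⊕ A≤1 ⊗ Q₀₁ ⊗ (B≤1 ⊗ 0≤p ⊕ 0≤B ⊗ 0≤X₁ ⊗ 0≤Y₁)
              ⊕ 0≤U ⊗ 0≤Y₁ ⊗ B≤1 ⊗ Q₁₀) Eq.refl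
          -- `(1 - A)(1 - B) ≥ 4/9` and `A B Z ≤ 2/5 p` leave `4/9 - 2/5 = 2/45` of `p`.
          K≥ : 0≤ # 45 :* K :- # 2 :* p
          K≥ = by (# 45 :* K :- # 2 :* p)
            (lit 5 ⊗ 0≤p ⊗ (lit 3 ⊗ 3A≤1 ⊗ B≤1 ⊕ lit 2 ⊗ 3B≤1)
              ⊕ lit 45 ⊗ AB≤p ⊗ 0≤X₁ ⊗ 0≤Y₁ ⊕ lit 9 ⊗ 0≤p ⊗ Z≤) Eq.refl

        large : 0≤ # 5 :* Z :- # 2 → 0≤ :- (# 1 :- X₁) :- (# 1 :- Y₁)
        -- The sign of `side` selects the end point; a negative sign is the same argument with the
        -- two families exchanged.
        large Z≥ = cases side 0≤-stable
          (λ s → [ L.holds (L.corner-dictates P>0 L.[ P≥0 ] L.[ 9P≤1 ] L.[ 3a≤1 ] L.[ 3b≤1 ] L.[ ab≤P ]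
             L.[ x₀≥0 ] L.[ x₀≤x₁ ] L.[ x₁≤1 ] L.[ y₀≥0 ] L.[ y₀≤y₁ ] L.[ y₁≤1 ]
             L.[ h₀₁ ] L.[ h₁₀ ] L.[ holds s ] L.[ holds Z≥ ] L.[ holds UV≥p ]) ])
          (λ s → by (:- (# 1 :- X₁) :- (# 1 :- Y₁)) (given (:- (# 1 :- Y₁) :- (# 1 :- X₁))
             (L′.holds (L′.corner-dictates P>0 L′.[ P≥0 ] L′.[ 9P≤1 ] L′.[ 3b≤1 ] L′.[ 3a≤1 ]
             L′.[ holds (by (p :- B :* A) AB≤p Eq.refl) ]
             L′.[ y₀≥0 ] L′.[ y₀≤y₁ ] L′.[ y₁≤1 ] L′.[ x₀≥0 ] L′.[ x₀≤x₁ ] L′.[ x₁≤1 ]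
             L′.[ holds (by (H Y₀ X₁) H₁₀ Eq.refl) ] L′.[ holds (by (H Y₁ X₀) H₀₁ Eq.refl) ]
             L′.[ holds (by (X₀ :* (Y₁ :- Y₀) :- Y₀ :* (X₁ :- X₀)) s Eq.refl) ]
             L′.[ holds (by (# 5 :* (Y₁ :* X₁) :- # 2) Z≥ Eq.refl) ]
             L′.[ holds (by (V :* U :- p) UV≥p Eq.refl) ]))) Eq.refl)
          where
          side : Polynomial 7
          side = Y₀ :* (X₁ :- X₀) :- X₀ :* (Y₁ :- Y₀)
          module L = LargeCorner {P} {a} {b} {x₀} {x₁} {y₀} {y₁}
          module L′ = LargeCorner {P} {b} {a} {y₀} {y₁} {x₀} {x₁}

    Irrelevant Dictating : Set
    Irrelevant = (NonNeg (x₀ - x₁) × NonNeg (y₀ - y₁)) × (NonNeg (x₀ * y₁ - P) × NonNeg (x₁ * y₀ - P))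
    Dictating = (NonNeg (- x₀) × NonNeg (x₁ - ι (+ 1))) × (NonNeg (- y₀) × NonNeg (y₁ - ι (+ 1)))

    -- `Z` is compared with `P` and with `2/5`. Up to `2/5`, `medium` brings `Z` down to `P` and
    -- `flat` applies; from `2/5` on, `large` forces `x₁ = y₁ = 1`.
    extremal : NonNeg (u * v - P) → ¬ ¬ (Irrelevant ⊎ Dictating)
    extremal uv≥P = cases (p :- Z) negated-stable (small ∘ flat UV≥p)
      λ _ → cases (# 5 :* Z :- # 2) negated-stable (full ∘ large UV≥p)
      λ Z≤ → small (flat UV≥p (medium UV≥p (by (# 2 :- # 5 :* Z) Z≤ Eq.refl)))
      where
      UV≥p : 0≤ U :* V :- p
      UV≥p = [ uv≥P ]
      small : 0≤ X₀ :- X₁ × 0≤ Y₀ :- Y₁ → ¬ ¬ (Irrelevant ⊎ Dictating)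
      small (hx , hy) k = k (inj₁
        ( (holds hx , holds hy)
        , ( holds (by (X₀ :* Y₁ :- p) (p≤Z UV≥p ⊕ hx ⊗ 0≤Y₁) Eq.refl)
          , holds (by (X₁ :* Y₀ :- p) (p≤Z UV≥p ⊕ 0≤X₁ ⊗ hy) Eq.refl))))
      full : 0≤ :- (# 1 :- X₁) :- (# 1 :- Y₁) → ¬ ¬ (Irrelevant ⊎ Dictating)
      full h k = k (inj₂
        ( (holds X₀≤0 , holds 1≤X₁) , (holds Y₀≤0 , holds 1≤Y₁)))
        where
        1≤X₁ : 0≤ X₁ :- # 1
        1≤X₁ = by (X₁ :- # 1) (h ⊕ 0≤β) Eq.refl
        1≤Y₁ : 0≤ Y₁ :- # 1
        1≤Y₁ = by (Y₁ :- # 1) (h ⊕ 0≤α) Eq.refl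
        -- At `y = 1` the Hoffman-type bound reads `x ≤ 0`.
        X₀≤0 : 0≤ :- X₀
        X₀≤0 = divide (# 3 :* p) 0<3p (by (# 3 :* p :* :- X₀)
          (H₀₁ ⊕ lit 3 ⊗ 0≤p ⊗ 1≤Y₁ ⊕ (lit 1 ⊕ 9p≤1) ⊗ 0≤X₀ ⊗ 0≤Y₁) Eq.refl)
        Y₀≤0 : 0≤ :- Y₀
        Y₀≤0 = divide (# 3 :* p) 0<3p (by (# 3 :* p :* :- Y₀)
          (H₁₀ ⊕ lit 3 ⊗ 0≤p ⊗ 1≤X₁ ⊕ (lit 1 ⊕ 9p≤1) ⊗ 0≤Y₀ ⊗ 0≤X₁) Eq.refl)

    -- Read off the equality analysis: where `u v ≥ P`, one of the two extremal shapes holds, and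
    -- each has `u v ≤ P`.
    product-step : NonNeg (P - u * v)
    product-step = holds (cases (U :* V :- p) 0≤-stable
      (λ h → 0≤-stable λ k → extremal (holds h) λ
        { (inj₁ ((x₁≤x₀ , y₁≤y₀) , _)) → k (by (p :- U :* V)
            (Q₁₀ ⊕ 0≤X₁ ⊗ given (Y₀ :- Y₁) y₁≤y₀ ⊕ 0≤X₁ ⊗ V≤Y₁ ⊕ U≤X₁ ⊗ 0≤V) Eq.refl)
        ; (inj₂ ((x₀≤0 , _) , (y₀≤0 , _))) → k (by (p :- U :* V)
            (AB≤p ⊕ 0≤A ⊗ (B≤1 ⊗ given (:- Y₀) y₀≤0 ⊕ 0≤B ⊗ 0≤β)
              ⊕ (A≤1 ⊗ given (:- X₀) x₀≤0 ⊕ 0≤A ⊗ 0≤α) ⊗ 0≤V) Eq.refl) })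
      (λ h → by (p :- U :* V) h Eq.refl))

-- Families as Boolean functions; sections, shadows and stars.

Cross : ∀ {n} → (Subset n → Bool) → (Subset n → Bool) → Set
Cross f g = ∀ x y → f x ≡ true → g y ≡ true → Nonempty (x ∩ y)

infix 4 _⊑_
_⊑_ : ∀ {n} → (Subset n → Bool) → (Subset n → Bool) → Set
f ⊑ g = ∀ x → f x ≡ true → g x ≡ true

IsStar : ∀ {n} → Fin n → (Subset n → Bool) → Set
IsStar ℓ f = ∀ x → f x ≡ lookup x ℓ

module _ {n} (f : Subset (suc n) → Bool) where

  section : Bool → Subset n → Bool
  section b x = f (b ∷ x)

  shadow : Subset n → Bool
  shadow x = f (false ∷ x) ∨ f (true ∷ x)

  section⊑shadow : ∀ b → section b ⊑ shadow
  section⊑shadow false x fx = cong (_∨ f (true ∷ x)) fx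
  section⊑shadow true  x fx = trans (cong (f (false ∷ x) ∨_) fx) (Bool.∨-zeroʳ (f (false ∷ x)))

  shadow-section : ∀ x → shadow x ≡ true → ∃ λ b → f (b ∷ x) ≡ true
  shadow-section x h with f (false ∷ x) in eq
  ... | true  = false , eq
  ... | false = true , h

nonempty-tail : ∀ {n} {x : Subset n} → Nonempty (false ∷ x) → Nonempty x
nonempty-tail (suc i , there i∈x) = i , i∈x

-- A set in the section at `false` lacks the coordinate, so the common element lies among the
-- others, whichever section of `g` the second set comes from.
cross-sectionˡ : ∀ {n} {f g : Subset (suc n) → Bool} → Cross f g →
  Cross (section f false) (shadow g)
cross-sectionˡ {g = g} cross x y fx gy =
  let b , gby = shadow-section g y gy in nonempty-tail (cross (false ∷ x) (b ∷ y) fx gby)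

cross-sectionʳ : ∀ {n} {f g : Subset (suc n) → Bool} → Cross f g →
  Cross (shadow f) (section g false)
cross-sectionʳ {f = f} cross x y fx gy with shadow-section f x fx
... | false , f0x = nonempty-tail (cross (false ∷ x) (false ∷ y) f0x gy)
... | true  , f1x = nonempty-tail (cross (true ∷ x) (false ∷ y) f1x gy)

-- The singleton of `k` lies in the star of `k`, hence in the star of `ℓ`.
star-injective : ∀ {n} {k ℓ : Fin n} {f g : Subset n → Bool} →
  IsStar k f → IsStar ℓ g → f ⊑ g → k ≡ ℓ
star-injective {k = k} {ℓ} f-star g-star f⊑g = sym (x∈⁅y⁆⇒x≡y k
  (lookup⇒[]= ℓ ⁅ k ⁆ (trans (sym (g-star ⁅ k ⁆))
    (f⊑g ⁅ k ⁆ (trans (f-star ⁅ k ⁆) ([]=⇒lookup (x∈⁅x⁆ k)))))))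

⊑-antisym : ∀ {n} {f g : Subset n → Bool} → f ⊑ g → g ⊑ f → ∀ x → f x ≡ g x
⊑-antisym {f = f} {g} f⊑g g⊑f x with f x in fx | g x in gx
... | false | false = refl
... | true  | true  = refl
... | true  | false = trans (sym (f⊑g x fx)) gx
... | false | true  = trans (sym fx) (g⊑f x gx)

-- The product measure, its monotonicity and its rigidity.

module Measure (R : OrderedRing) where
  open OrderedRing R
  open Certificates R

  -- Conditioning on the first coordinate makes one unfolding a weighted mean of the kind treated in
  -- `Step`; `sum-weight` identifies the result with the sum over the members.
  measure : ∀ {n} → (Fin n → Carrier) → (Subset n → Bool) → Carrier
  measure {zero}  p f = if f [] then ι (+ 1) else ι (+ 0)
  measure {suc n} p f =
    (ι (+ 1) - p zero) * measure (p ∘ suc) (section f false)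
      + p zero * measure (p ∘ suc) (section f true)

  IsSmall : ∀ {n} → (Fin n → Carrier) → Set
  IsSmall p = ∀ ℓ → Pos (p ℓ) × NonNeg (p ℓ) × NonNeg (ι (+ 1) - ι (+ 3) * p ℓ)

  private
    p x y x′ y′ : Polynomial 5
    p = var 0F
    x = var 1F
    y = var 2F
    x′ = var 3F
    y′ = var 4F
    mean : Polynomial 5 → Polynomial 5 → Polynomial 5
    mean s t = (# 1 :- p) :* s :+ p :* t

  complement-nonNeg : ∀ {q} → NonNeg q → NonNeg (ι (+ 1) - ι (+ 3) * q) → NonNeg (ι (+ 1) - q)
  complement-nonNeg {q} q≥0 3q≤1 =
    holds (by (# 1 :- e) (given (# 1 :- # 3 :* e) 3q≤1 ⊕ lit 2 ⊗ given e q≥0) Eq.refl)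
    where
    open At (q ∷ [])
    e : Polynomial 1
    e = var 0F

  measure-mono : ∀ {n} {q : Fin n → Carrier} → IsSmall q → ∀ {f g} → f ⊑ g →
    NonNeg (measure q g - measure q f)
  measure-mono {zero} {q} _ {f} {g} f⊑g with f [] in f[] | g [] in g[]
  ... | false | false = holds (by (# 0 :- # 0) (lit 0) Eq.refl)
    where open At []
  ... | false | true  = holds (by (# 1 :- # 0) (lit 1) Eq.refl)
    where open At []
  ... | true  | true  = holds (by (# 1 :- # 1) (lit 0) Eq.refl)
    where open At []
  ... | true  | false with () ← trans (sym g[]) (f⊑g [] f[])
  measure-mono {suc n} {q} small {f} {g} f⊑g = holds (by (mean x′ y′ :- mean x y)
    (given (# 1 :- p) (complement-nonNeg q≥0 3q≤1) ⊗ given (x′ :- x) (mono false)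
      ⊕ given p q≥0 ⊗ given (y′ :- y) (mono true)) Eq.refl)
    where
    q≥0 = proj₁ (proj₂ (small zero))
    3q≤1 = proj₂ (proj₂ (small zero))
    m : (Subset (suc n) → Bool) → Bool → Carrier
    m h b = measure (q ∘ suc) (section h b)
    mono : ∀ b → NonNeg (m g b - m f b)
    mono b = measure-mono (small ∘ suc) (f⊑g ∘ (b ∷_))
    open At (q zero ∷ m f false ∷ m f true ∷ m g false ∷ m g true ∷ [])

  -- Every set has positive mass. As the sections of `g` dominate those of `f`, equality of the
  -- weighted means passes to each section.
  measure-rigid : ∀ {n} {q : Fin n → Carrier} → IsSmall q → ∀ {f g} → f ⊑ g →
    NonNeg (measure q f - measure q g) → g ⊑ f
  measure-rigid {zero} _ {f} {g} f⊑g h [] gx with f []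
  ... | true  = refl
  ... | false rewrite gx = contradiction (holds (by (:- # 1) (given (# 0 :- # 1) h) Eq.refl)) (pos-ι 0)
    where open At []
  measure-rigid {suc n} {q} small {f} {g} f⊑g h (b ∷ xs) gx =
    measure-rigid (small ∘ suc) (f⊑g ∘ (b ∷_)) (rigid b) xs gx
    where
    q>0 = proj₁ (small zero)
    q≥0 = proj₁ (proj₂ (small zero))
    3q≤1 = proj₂ (proj₂ (small zero))
    m : (Subset (suc n) → Bool) → Bool → Carrier
    m h b = measure (q ∘ suc) (section h b)
    open At (q zero ∷ m f false ∷ m f true ∷ m g false ∷ m g true ∷ [])
    0≤p : 0≤ p
    0≤p = given p q≥0
    mono : ∀ b → NonNeg (m g b - m f b)
    mono b = measure-mono (small ∘ suc) (f⊑g ∘ (b ∷_))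
    eq : 0≤ mean x y :- mean x′ y′
    eq = given (mean x y :- mean x′ y′) h
    rigid : ∀ b → NonNeg (m f b - m g b)
    -- `3 (1 - p) ≥ 2` stands in for a division by `1 - p`.
    rigid false = holds (divide (# 2) (pos-ι 1) (by (# 2 :* (x :- x′))
      (lit 3 ⊗ eq ⊕ lit 3 ⊗ 0≤p ⊗ given (y′ :- y) (mono true)
        ⊕ given (# 1 :- # 3 :* p) 3q≤1 ⊗ given (x′ :- x) (mono false)) Eq.refl))
    rigid true = holds (divide p q>0 (by (p :* (y :- y′))
      (eq ⊕ given (# 1 :- p) (complement-nonNeg q≥0 3q≤1) ⊗ given (x′ :- x) (mono false)) Eq.refl))

  measure-const : ∀ {n} (q : Fin n → Carrier) b →
    measure q (const b) ≈ (if b then ι (+ 1) else ι (+ 0))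
  measure-const {zero}  q b = Eq.refl
  measure-const {suc n} q b = Eq.trans
    (Eq.+-cong (Eq.*-cong Eq.refl ih) (Eq.*-cong Eq.refl ih))
    (prove (q zero ∷ (if b then ι (+ 1) else ι (+ 0)) ∷ [])
      ((# 1 :- var 0F) :* var 1F :+ var 0F :* var 1F) (var 1F) Eq.refl)
    where ih = measure-const (q ∘ suc) b

  measure-nonNeg : ∀ {n} {q : Fin n → Carrier} → IsSmall q → ∀ f → NonNeg (measure q f)
  measure-nonNeg {q = q} small f = nonNeg-resp
    (Eq.trans (Eq.+-cong Eq.refl (Eq.-‿cong (measure-const q false)))
      (prove (measure q f ∷ []) (var 0F :- # 0) (var 0F) Eq.refl))
    (measure-mono small {const false} λ _ ())

  measure-≤1 : ∀ {n} {q : Fin n → Carrier} → IsSmall q → ∀ f → NonNeg (ι (+ 1) - measure q f)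
  measure-≤1 {q = q} small f = nonNeg-resp
    (Eq.+-cong (measure-const q true) Eq.refl)
    (measure-mono small {g = const true} λ _ _ → refl)

  measure-null : ∀ {n} {q : Fin n → Carrier} → IsSmall q → ∀ {f} →
    NonNeg (- measure q f) → ∀ x → f x ≡ false
  measure-null {q = q} small {f} h = ⊑-antisym
    (measure-rigid small {const false} (λ _ ())
      (nonNeg-resp (Eq.trans
        (prove (measure q f ∷ []) (:- var 0F) (# 0 :- var 0F) Eq.refl)
        (Eq.+-cong (Eq.sym (measure-const q false)) Eq.refl)) h))
    λ _ ()

  measure-full : ∀ {n} {q : Fin n → Carrier} → IsSmall q → ∀ {f} →
    NonNeg (measure q f - ι (+ 1)) → ∀ x → f x ≡ true
  measure-full {q = q} small {f} h x = measure-rigid small {g = const true} (λ _ _ → refl)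
    (nonNeg-resp (Eq.+-cong Eq.refl (Eq.-‿cong (Eq.sym (measure-const q true)))) h) x refl

  measure-cong : ∀ {n} (q : Fin n → Carrier) {f g} → (∀ x → f x ≡ g x) → measure q f ≈ measure q g
  measure-cong {zero}  q f≗g = Eq.reflexive (cong (if_then ι (+ 1) else ι (+ 0)) (f≗g []))
  measure-cong {suc n} q f≗g = Eq.+-cong
    (Eq.*-cong Eq.refl (measure-cong (q ∘ suc) (f≗g ∘ (false ∷_))))
    (Eq.*-cong Eq.refl (measure-cong (q ∘ suc) (f≗g ∘ (true ∷_))))

  measure-star : ∀ {n} (q : Fin n → Carrier) {f} ℓ → IsStar ℓ f → measure q f ≈ q ℓ
  measure-star q {f} zero star = Eq.trans
    (Eq.+-cong (Eq.*-cong Eq.refl (section-const false)) (Eq.*-cong Eq.refl (section-const true)))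
    (prove (q zero ∷ []) ((# 1 :- var 0F) :* # 0 :+ var 0F :* # 1) (var 0F) Eq.refl)
    where
    section-const : ∀ b → measure (q ∘ suc) (section f b) ≈ (if b then ι (+ 1) else ι (+ 0))
    section-const b = Eq.trans (measure-cong (q ∘ suc) (star ∘ (b ∷_))) (measure-const (q ∘ suc) b)
  measure-star q {f} (suc ℓ) star = Eq.trans
    (Eq.+-cong (Eq.*-cong Eq.refl (ih false)) (Eq.*-cong Eq.refl (ih true)))
    (prove (q zero ∷ q (suc ℓ) ∷ [])
      ((# 1 :- var 0F) :* var 1F :+ var 0F :* var 1F) (var 1F) Eq.refl)
    where
    ih : ∀ b → measure (q ∘ suc) (section f b) ≈ q (suc ℓ)
    ih b = measure-star (q ∘ suc) ℓ (star ∘ (b ∷_))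

-- Induction on the number of coordinates.

module CrossIntersection (R : OrderedRing) where
  open OrderedRing R
  open Certificates R
  open Measure R
  open Region R

  module _ {P : Carrier} (P>0 : Pos P) (P≥0 : NonNeg P) (9P≤1 : NonNeg (ι (+ 1) - ι (+ 9) * P)) where

    -- The inductive statement. `equality` is doubly negated because `extremal` is; decidability of
    -- `IsStar` removes this at the end.
    record Bound {n} (p q : Fin n → Carrier) (f g : Subset n → Bool) : Set where
      field
        hoffman-bound : NonNeg (hoffman P (measure p f) (measure q g))
        product-bound : NonNeg (P - measure p f * measure q g)
        equality      : NonNeg (measure p f * measure q g - P) →
                        ¬ ¬ ∃ λ ℓ → IsStar ℓ f × IsStar ℓ g
    open Bound public

    -- A section at true only enters through its measure, so that it may be
    -- replaced by the larger union of the two sections.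
    module Induction {n} {p q : Fin (suc n) → Carrier} (p-small : IsSmall p) (q-small : IsSmall q)
      (pq≤P : NonNeg (P - p zero * q zero)) {f g : Subset (suc n) → Bool}
      (left  : Bound (p ∘ suc) (q ∘ suc) (section f false) (shadow g))
      (right : Bound (p ∘ suc) (q ∘ suc) (shadow f) (section g false)) where
      private
        p′ q′ : Fin n → Carrier
        p′ = p ∘ suc
        q′ = q ∘ suc
        p′-small : IsSmall p′
        p′-small = p-small ∘ suc
        q′-small : IsSmall q′
        q′-small = q-small ∘ suc

        open Step P>0 P≥0 9P≤1
          (proj₁ (proj₂ (p-small zero))) (proj₂ (proj₂ (p-small zero)))
          (proj₁ (proj₂ (q-small zero))) (proj₂ (proj₂ (q-small zero))) pq≤P
          (measure-nonNeg p′-small (section f false))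
          (measure-mono p′-small (section⊑shadow f false)) (measure-≤1 p′-small (shadow f))
          (measure-nonNeg q′-small (section g false))
          (measure-mono q′-small (section⊑shadow g false)) (measure-≤1 q′-small (shadow g))
          (product-bound left) (hoffman-bound left) (product-bound right) (hoffman-bound right)

        module Raise (r : Fin (suc n) → Carrier) (r-small : IsSmall r) (h : Subset (suc n) → Bool) where
          σ : Vec Carrier 4
          σ = r zero ∷ measure (r ∘ suc) (section h false) ∷ measure (r ∘ suc) (section h true)
                ∷ measure (r ∘ suc) (shadow h) ∷ []
          open At σ
          w s t t′ : Polynomial 4
          w = var 0F
          s = var 1F
          t = var 2F
          t′ = var 3F
          mean : Polynomial 4 → Polynomial 4
          mean z = (# 1 :- w) :* s :+ w :* z

          raised : Carrier
          raised = ⟦ mean t′ ⟧ σ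

          gap : NonNeg (raised - measure r h)
          gap = holds (by (mean t′ :- mean t)
            (given w (proj₁ (proj₂ (r-small zero)))
              ⊗ given (t′ :- t) (measure-mono (r-small ∘ suc) (section⊑shadow h true))) Eq.refl)

          raised-nonNeg : NonNeg raised
          raised-nonNeg = holds (by (mean t′)
            (given (mean t) (measure-nonNeg r-small h) ⊕ given (mean t′ :- mean t) gap) Eq.refl)

          -- `raised` exceeds the measure by `r zero` times the gap between the shadow and the
          -- section at `true`. As `r zero > 0`, rigidity makes the two families equal.
          section-full : NonNeg (measure r h - raised) → ∀ x → section h true x ≡ shadow h x
          section-full flat = ⊑-antisym (section⊑shadow h true)
            (measure-rigid (r-small ∘ suc) (section⊑shadow h true)
              (holds (divide w (proj₁ (r-small zero)) (by (w :* (t :- t′))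
                (given (mean t :- mean t′) flat) Eq.refl))))

        module X = Raise p p-small f
        module Y = Raise q q-small g

        ρ : Vec Carrier 5
        ρ = P ∷ u ∷ v ∷ measure p f ∷ measure q g ∷ []
        open At ρ

        e U V u′ v′ : Polynomial 5
        e  = var 0F
        U  = var 1F
        V  = var 2F
        u′ = var 3F
        v′ = var 4F

        lower : NonNeg (u * v - measure p f * measure q g)
        lower = product-monotone {P} Y.raised-nonNeg (measure-nonNeg p-small f) X.gap Y.gap

      bound : Bound p q f g
      bound = record
        { hoffman-bound = hoffman-antitone Y.raised-nonNeg (measure-nonNeg p-small f) X.gap Y.gap
            P≥0 9P≤1 hoffman-step
        ; product-bound = holds (by (e :- u′ :* v′)
            (given (e :- U :* V) product-step ⊕ given (U :* V :- u′ :* v′) lower) Eq.refl)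
        ; equality = λ u′v′≥P → tight (given (u′ :* v′ :- e) u′v′≥P)
        }
        where
        tight : 0≤ u′ :* v′ :- e → ¬ ¬ ∃ λ ℓ → IsStar ℓ f × IsStar ℓ g
        tight ≥e k = extremal (holds UV≥e) λ
          -- Both smaller pairs attain `P`, so induction gives each a common star, and `merge`
          -- identifies the two.
          { (inj₁ (_ , (x₀y₁≥P , x₁y₀≥P))) →
              equality left x₀y₁≥P λ { (i , f₀-star , g-star) →
              equality right x₁y₀≥P λ { (j , f-star , g₀-star) →
              k (merge i j f₀-star g-star f-star g₀-star) } }
          ; (inj₂ ((f₀-null , f-full) , (g₀-null , g-full))) → k (zero ,
              star₀ f (measure-null p′-small f₀-null) (measure-full p′-small f-full) ,
              star₀ g (measure-null q′-small g₀-null) (measure-full q′-small g-full)) }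
          where
          UV≥e : 0≤ U :* V :- e
          UV≥e = by (U :* V :- e) (≥e ⊕ given (U :* V :- u′ :* v′) lower) Eq.refl
          u′v′-tight : 0≤ (u′ :* v′ :- e) :+ (e :- U :* V)
          u′v′-tight = ≥e ⊕ given (e :- U :* V) product-step
          u-gap : 0≤ U :- u′
          u-gap = given (U :- u′) X.gap
          v-gap : 0≤ V :- v′
          v-gap = given (V :- v′) Y.gap
          0≤U : 0≤ U
          0≤U = given U X.raised-nonNeg
          0≤v′ : 0≤ v′
          0≤v′ = given v′ (measure-nonNeg q-small g)
          u′≥e : 0≤ u′ :- e
          u′≥e = by (u′ :- e) (≥e ⊕ given u′ (measure-nonNeg p-small f)
            ⊗ given (# 1 :- v′) (measure-≤1 q-small g)) Eq.refl
          v′≥e : 0≤ v′ :- e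
          v′≥e = by (v′ :- e) (≥e ⊕ 0≤v′ ⊗ given (# 1 :- u′) (measure-≤1 p-small f)) Eq.refl
          -- `U V ≤ P ≤ u′ v′` with `u′ ≤ U` and `v′ ≤ V` leaves no room in either factor, because
          -- the other one is at least `P > 0`.
          u′≥U : 0≤ u′ :- U
          u′≥U = divide e P>0 (by (e :* (u′ :- U))
            (v′≥e ⊗ u-gap ⊕ u′v′-tight ⊕ 0≤U ⊗ v-gap) Eq.refl)
          v′≥V : 0≤ v′ :- V
          v′≥V = divide e P>0 (by (e :* (v′ :- V))
            ((u′≥e ⊕ u-gap) ⊗ v-gap ⊕ u′v′-tight ⊕ u-gap ⊗ 0≤v′) Eq.refl)
          star₀ : ∀ h → (∀ x → section h false x ≡ false) → (∀ x → shadow h x ≡ true) → IsStar zero h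
          star₀ h null full (false ∷ x) = null x
          star₀ h null full (true ∷ x) = trans (cong (_∨ h (true ∷ x)) (sym (null x))) (full x)
          merge : ∀ i j → IsStar i (section f false) → IsStar i (shadow g) →
            IsStar j (shadow f) → IsStar j (section g false) → ∃ λ ℓ → IsStar ℓ f × IsStar ℓ g
          merge i j f₀-star g-star f-star g₀-star
            -- `section f false`, the star of `i`, lies in `shadow f`, the star of `j`.
            with refl ← star-injective f₀-star f-star (section⊑shadow f false) =
            suc i
            , (λ { (false ∷ x) → f₀-star x
                 ; (true ∷ x) → trans (X.section-full (holds u′≥U) x) (f-star x) })
            , (λ { (false ∷ x) → g₀-star x
                 ; (true ∷ x) → trans (Y.section-full (holds v′≥V) x) (g-star x) })

    private
      open At (P ∷ [])
      e : Polynomial 1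
      e = var 0F
      0≤e : 0≤ e
      0≤e = given e P≥0

      -- For `n = 0` the measures are 0 or 1 and not both 1, so the product is 0, and `P > 0`
      -- excludes equality.
      point-values : ∀ b c → ¬ (b ≡ true × c ≡ true) →
        let x = if b then ι (+ 1) else ι (+ 0)
            y = if c then ι (+ 1) else ι (+ 0) in
        NonNeg (hoffman P x y) × NonNeg (P - x * y) × ¬ NonNeg (x * y - P)
      point-values true true disjoint = contradiction (refl , refl) disjoint
      point-values true false _ =
          holds (by (hoffmanᵖ e (# 1) (# 0)) (lit 0) Eq.refl)
        , holds (by (e :- # 1 :* # 0) 0≤e Eq.refl)
        , P>0 ∘ λ h → holds (by (:- e) (given (# 1 :* # 0 :- e) h) Eq.refl)
      point-values false true _ =
          holds (by (hoffmanᵖ e (# 0) (# 1)) (lit 0) Eq.refl)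
        , holds (by (e :- # 0 :* # 1) 0≤e Eq.refl)
        , P>0 ∘ λ h → holds (by (:- e) (given (# 0 :* # 1 :- e) h) Eq.refl)
      point-values false false _ =
          holds (by (hoffmanᵖ e (# 0) (# 0)) (lit 3 ⊗ 0≤e) Eq.refl)
        , holds (by (e :- # 0 :* # 0) 0≤e Eq.refl)
        , P>0 ∘ λ h → holds (by (:- e) (given (# 0 :* # 0 :- e) h) Eq.refl)

    bound-zero : ∀ {p q : Fin 0 → Carrier} f g → Cross f g → Bound p q f g
    bound-zero f g cross = record
      { hoffman-bound = proj₁ values
      ; product-bound = proj₁ (proj₂ values)
      ; equality      = λ h → contradiction h (proj₂ (proj₂ values))
      }
      where
      disjoint : ¬ (f [] ≡ true × g [] ≡ true)
      disjoint (f[] , g[]) with () ← proj₁ (cross [] [] f[] g[])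
      values = point-values (f []) (g []) disjoint

    -- `P` stays fixed through the recursion: the smaller vectors inherit the upper bound on
    -- `p ℓ * q ℓ`, while a coordinate attaining it may be lost.
    cross-bound : ∀ {n} {p q : Fin n → Carrier} → IsSmall p → IsSmall q →
      (∀ ℓ → NonNeg (P - p ℓ * q ℓ)) → ∀ f g → Cross f g → Bound p q f g
    cross-bound {zero}  _ _ _ f g cross = bound-zero f g cross
    cross-bound {suc n} p-small q-small pq≤P f g cross =
      Induction.bound p-small q-small (pq≤P zero)
        (cross-bound (p-small ∘ suc) (q-small ∘ suc) (pq≤P ∘ suc) _ _ (cross-sectionˡ {f = f} {g} cross))
        (cross-bound (p-small ∘ suc) (q-small ∘ suc) (pq≤P ∘ suc) _ _ (cross-sectionʳ {f = f} {g} cross))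

  module _ {n} {p q : Fin (suc n) → Carrier} (p-small : IsSmall p) (q-small : IsSmall q)
    (maximal : ∀ ℓ → NonNeg (p zero * q zero - p ℓ * q ℓ))
    {f g : Subset (suc n) → Bool} (cross : Cross f g) where
    private
      open At (p zero ∷ q zero ∷ [])
      a b : Polynomial 2
      a = var 0F
      b = var 1F
      P : Carrier
      P = p zero * q zero
      0≤a : 0≤ a
      0≤a = given a (proj₁ (proj₂ (p-small zero)))
      0≤b : 0≤ b
      0≤b = given b (proj₁ (proj₂ (q-small zero)))
      3a≤1 : 0≤ # 1 :- # 3 :* a
      3a≤1 = given (# 1 :- # 3 :* a) (proj₂ (proj₂ (p-small zero)))
      3b≤1 : 0≤ # 1 :- # 3 :* b
      3b≤1 = given (# 1 :- # 3 :* b) (proj₂ (proj₂ (q-small zero)))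
      bound = cross-bound (pos-* (proj₁ (p-small zero)) (proj₁ (q-small zero))) (holds (0≤a ⊗ 0≤b))
        (holds (by (# 1 :- # 9 :* (a :* b)) (3a≤1 ⊕ lit 3 ⊗ 0≤a ⊗ 3b≤1) Eq.refl))
        p-small q-small maximal f g cross

    cross-product-bound : NonNeg (P - measure p f * measure q g)
    cross-product-bound = product-bound bound

    cross-equality : measure p f * measure q g ≈ P → ¬ ¬ ∃ λ ℓ → IsStar ℓ f × IsStar ℓ g
    cross-equality eq = equality bound (nonNeg-resp
      (Eq.trans (prove (P ∷ []) (# 0) (var 0F :- var 0F) Eq.refl) (Eq.+-cong (Eq.sym eq) Eq.refl))
      (nonNeg-ι 0))

-- The recursive measure as a sum over the members.

foldr-filter-map : ∀ {A B C : Set} {P : Pred B 0ℓ} {Q : Pred A 0ℓ}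
  (P? : Decidable P) (Q? : Decidable Q) (g : A → B) →
  (∀ a → does (P? (g a)) ≡ does (Q? a)) → ∀ (_∙_ : B → C → C) e xs →
  foldr _∙_ e (filter P? (List.map g xs)) ≡ foldr (λ a → g a ∙_) e (filter Q? xs)
foldr-filter-map P? Q? g P≗Q _∙_ e [] = refl
foldr-filter-map P? Q? g P≗Q _∙_ e (x ∷ xs) with ih ← foldr-filter-map P? Q? g P≗Q _∙_ e xs
  rewrite P≗Q x with does (Q? x)
... | true  = cong (g x ∙_) ih
... | false = ih

module MeasureAsSum (R : OrderedRing) where
  open OrderedRing R
  open Certificates R using (module Eq)
  open _-Raw-AlmostCommutative⟶_ morphism using (0-homo; 1-homo)
  open Measure R using (measure)

  sum product : {A : Set} → List A → (A → Carrier) → Carrier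
  sum     xs f = foldr (λ a s → f a + s) Eq.0# xs
  product xs f = foldr (λ a s → f a * s) Eq.1# xs

  weight : ∀ {n} → (Fin n → Carrier) → Subset n → Carrier
  weight p x = product (elements x) p * product (elements (∁ x)) (λ k → Eq.1# - p k)

  product-tail : ∀ {n} b (x : Subset n) (f : Fin (suc n) → Carrier) →
    product (filter (_∈? (b ∷ x)) (List.tabulate suc)) f ≡ product (elements x) (f ∘ suc)
  product-tail b x f = trans
    (cong (λ is → product (filter (_∈? (b ∷ x)) is) f) (sym (map-tabulate (λ i → i) suc)))
    (foldr-filter-map (_∈? (b ∷ x)) (_∈? x) suc (λ _ → refl) (λ i s → f i * s) Eq.1# (allFin _))

  coordinate : ∀ {n} → (Fin (suc n) → Carrier) → Bool → Carrier
  coordinate p b = if b then p zero else Eq.1# - p zero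

  weight-∷ : ∀ {n} (p : Fin (suc n) → Carrier) b (x : Subset n) →
    weight p (b ∷ x) ≈ coordinate p b * weight (p ∘ suc) x
  weight-∷ p true x = Eq.trans
    (Eq.reflexive (cong₂ (λ s t → (p zero * s) * t) (product-tail true x p)
      (product-tail false (∁ x) (λ k → Eq.1# - p k))))
    (Eq.*-assoc _ _ _)
  weight-∷ p false x = Eq.trans
    (Eq.reflexive (cong₂ (λ s t → s * ((Eq.1# - p zero) * t)) (product-tail false x p)
      (product-tail true (∁ x) (λ k → Eq.1# - p k))))
    (x∙yz≈y∙xz _ _ _)
    where open CommutativeSemigroupProperties Eq.*-commutativeSemigroup using (x∙yz≈y∙xz)

  sum-++ : ∀ {A : Set} (xs ys : List A) f → sum (xs ++ ys) f ≈ sum xs f + sum ys f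
  sum-++ []       ys f = Eq.sym (Eq.+-identityˡ _)
  sum-++ (x ∷ xs) ys f = Eq.trans (Eq.+-congˡ (sum-++ xs ys f)) (Eq.sym (Eq.+-assoc _ _ _))

  sum-scale : ∀ {A : Set} c {f g : A → Carrier} → (∀ x → g x ≈ c * f x) →
    ∀ xs → sum xs g ≈ c * sum xs f
  sum-scale c g≈cf []       = Eq.sym (Eq.zeroʳ c)
  sum-scale c g≈cf (x ∷ xs) =
    Eq.trans (Eq.+-cong (g≈cf x) (sum-scale c g≈cf xs)) (Eq.sym (Eq.distribˡ _ _ _))

  sum-weight : ∀ {n} (p : Fin n → Carrier) {U : Pred (Subset n) 0ℓ} (U? : Decidable U) →
    sum (filter U? (allSubsets n)) (weight p) ≈ measure p (does ∘ U?)
  sum-weight {zero} p U? with does (U? [])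
  ... | true  = Eq.trans (Eq.+-identityʳ _) (Eq.trans (Eq.*-identityˡ _) (Eq.sym 1-homo))
  ... | false = Eq.sym 0-homo
  sum-weight {suc n} p {U} U? = Eq.trans
    (Eq.reflexive (cong (λ xs → sum xs (weight p)) (filter-++ U? (cons true) (cons false))))
    (Eq.trans (sum-++ (filter U? (cons true)) (filter U? (cons false)) (weight p))
    -- `allSubsets` lists the sets with the first coordinate first, whereas `measure` starts with
    -- the section at `false`.
    (Eq.trans (Eq.+-comm _ _) (Eq.+-cong
      (Eq.trans (part≈ false) (Eq.*-congʳ (Eq.+-congʳ (Eq.sym 1-homo)))) (part≈ true))))
    where
    cons : Bool → List (Subset (suc n))
    cons b = List.map (b ∷_) (allSubsets n)
    part≈ : ∀ b → sum (filter U? (cons b)) (weight p)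
                  ≈ coordinate p b * measure (p ∘ suc) (section (does ∘ U?) b)
    part≈ b = Eq.trans
      (Eq.reflexive (foldr-filter-map U? (U? ∘ (b ∷_)) (b ∷_) (λ _ → refl)
        (λ x s → weight p x + s) Eq.0# (allSubsets n)))
      (Eq.trans (sum-scale (coordinate p b) (weight-∷ p b) (filter (U? ∘ (b ∷_)) (allSubsets n)))
        (Eq.*-congˡ (sum-weight (p ∘ suc) (U? ∘ (b ∷_)))))

isStar? : ∀ {n} (ℓ : Fin n) f → Dec (IsStar ℓ f)
isStar? ℓ f = map′
  (λ none x → decidable-stable (f x Bool.≟ lookup x ℓ) (λ x≢ → none (x , x≢)))
  (λ star (x , x≢) → x≢ (star x))
  (¬? (anySubset? λ x → ¬? (f x Bool.≟ lookup x ℓ)))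

open import Defs

-- The Cauchy reals as an ordered ring.

module Reals where
  open ℚ-Solver.+-*-Solver using (solve; _:=_; con; _:+_; _:*_; _:-_; :-_)
  open Cauchy using (half+half; half-pos; bounded; shrink; +-difference; *-difference; telescope; ∣*∣-bound)

  eventually₂ : ∀ {P Q S : ℕ → Set} → (∀ n → P n → Q n → S n) →
    Eventually P → Eventually Q → Eventually S
  eventually₂ f (M , p) (N , q) = M ℕ.⊔ N , λ n h →
    f n (p n (ℕₚ.m⊔n≤o⇒m≤o M N h)) (q n (ℕₚ.m⊔n≤o⇒n≤o M N h))

  eventually : ∀ {P Q : ℕ → Set} → (∀ n → P n → Q n) → Eventually P → Eventually Q
  eventually f (N , p) = N , λ n h → f n (p n h)

  p≤∣p∣ : ∀ p → p ℚ.≤ ℚ.∣ p ∣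
  p≤∣p∣ p with ℚₚ.≤-total 0ℚ p
  ... | inj₁ 0≤p = ℚₚ.≤-reflexive (sym (ℚₚ.0≤p⇒∣p∣≡p 0≤p))
  ... | inj₂ p≤0 = ℚₚ.≤-trans p≤0 (ℚₚ.0≤∣p∣ p)

  0<q-p : ∀ {p q} → p ℚ.< q → 0ℚ ℚ.< q ℚ.- p
  0<q-p {p} {q} p<q = subst (ℚ._< q ℚ.- p) (ℚₚ.+-inverseʳ p) (ℚₚ.+-monoˡ-< (ℚ.- p) p<q)

  0<q-p⁻¹ : ∀ {p q} → 0ℚ ℚ.< q ℚ.- p → p ℚ.< q
  0<q-p⁻¹ {p} {q} h = subst₂ ℚ._<_ (ℚₚ.+-identityˡ p)
    (solve 2 (λ p q → (q :- p) :+ p := q) refl p q) (ℚₚ.+-monoˡ-< p h)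

  0≤q-p : ∀ {p q} → p ℚ.≤ q → 0ℚ ℚ.≤ q ℚ.- p
  0≤q-p {p} {q} p≤q = subst (ℚ._≤ q ℚ.- p) (ℚₚ.+-inverseʳ p) (ℚₚ.+-monoˡ-≤ (ℚ.- p) p≤q)

  0<* : ∀ {p q} → 0ℚ ℚ.< p → 0ℚ ℚ.< q → 0ℚ ℚ.< p ℚ.* q
  0<* {p} {q} 0<p 0<q = ℚₚ.positive⁻¹ (p ℚ.* q)
    {{ℚₚ.pos*pos⇒pos p {{ℚ.positive 0<p}} q {{ℚ.positive 0<q}}}}

  0≤* : ∀ {p q} → 0ℚ ℚ.≤ p → 0ℚ ℚ.≤ q → 0ℚ ℚ.≤ p ℚ.* q
  0≤* {p} {q} 0≤p 0≤q = ℚₚ.nonNegative⁻¹ (p ℚ.* q)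
    {{ℚₚ.nonNeg*nonNeg⇒nonNeg p {{ℚ.nonNegative 0≤p}} q {{ℚ.nonNegative 0≤q}}}}

  ∣p∣<ε⇒0<ε-p : ∀ {p ε} → ℚ.∣ p ∣ ℚ.< ε → 0ℚ ℚ.< ε ℚ.- p
  ∣p∣<ε⇒0<ε-p {p} h = 0<q-p (ℚₚ.≤-<-trans (p≤∣p∣ p) h)

  Null : (ℕ → ℚ) → Set
  Null s = ∀ ε → 0ℚ ℚ.< ε → Eventually λ n → ℚ.∣ s n ∣ ℚ.< ε

  null-resp : ∀ {s t} → (∀ n → s n ≡ t n) → Null s → Null t
  null-resp s≗t s-null ε 0<ε =
    eventually (λ n → subst (λ d → ℚ.∣ d ∣ ℚ.< ε) (s≗t n)) (s-null ε 0<ε)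

  null-+ : ∀ {s t} → Null s → Null t → Null (λ n → s n ℚ.+ t n)
  null-+ {s} {t} s-null t-null ε 0<ε = eventually₂
    (λ n hs ht → ℚₚ.≤-<-trans (ℚₚ.∣p+q∣≤∣p∣+∣q∣ (s n) (t n))
      (subst (ℚ.∣ s n ∣ ℚ.+ ℚ.∣ t n ∣ ℚ.<_) (half+half ε) (ℚₚ.+-mono-< hs ht)))
    (s-null (½ ℚ.* ε) (half-pos 0<ε)) (t-null (½ ℚ.* ε) (half-pos 0<ε))

  null-neg : ∀ {s} → Null s → Null (λ n → ℚ.- s n)
  null-neg {s} s-null ε 0<ε =
    eventually (λ n → subst (ℚ._< ε) (sym (ℚₚ.∣-p∣≡∣p∣ (s n)))) (s-null ε 0<ε)

  null-* : ∀ {s t} → IsCauchy s → Null t → Null (λ n → s n ℚ.* t n)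
  null-* {s} {t} s-cauchy t-null ε 0<ε =
    let B , B>0 , s≤B = bounded s s-cauchy
        δ , 0<δ , Bδ≡ = shrink B B>0 ε 0<ε
    in eventually₂
      (λ n s≤B t<δ → ℚₚ.<-trans (∣*∣-bound (s n) (t n) B>0 s≤B t<δ)
        (subst₂ ℚ._<_ (trans (ℚₚ.+-identityʳ (½ ℚ.* ε)) (sym Bδ≡)) (half+half ε)
          (ℚₚ.+-monoʳ-< (½ ℚ.* ε) (half-pos 0<ε))))
      s≤B (t-null δ 0<δ)

  -- The records make x and y recoverable from the type, which _≈_ and _≤_ do not.
  infix 4 _≋_
  record _≋_ (x y : ℝ) : Set where
    constructor ≈⇒≋
    field ≋⇒≈ : x ≈ y
  open _≋_ public

  record NonNegative (x : ℝ) : Set where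
    constructor 0≤⇒nonNeg
    field nonNeg⇒0≤ : 0ℝ ≤ x
  open NonNegative public

  pointwise : ∀ {x y} → (∀ n → seq x n ≡ seq y n) → x ≋ y
  pointwise {x} {y} x≗y = ≈⇒≋ λ ε 0<ε → 0 , λ n _ → subst (ℚ._< ε)
    (sym (trans (cong (λ q → ℚ.∣ q ℚ.- seq y n ∣) (x≗y n)) (cong ℚ.∣_∣ (ℚₚ.+-inverseʳ (seq y n))))) 0<ε

  ≋-sym : ∀ {x y} → x ≋ y → y ≋ x
  ≋-sym {x} {y} (≈⇒≋ x≈y) = ≈⇒≋ (null-resp
    (λ n → solve 2 (λ a b → :- (a :- b) := b :- a) refl (seq x n) (seq y n)) (null-neg x≈y))

  ≋-trans : ∀ {x y z} → x ≋ y → y ≋ z → x ≋ z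
  ≋-trans {x} {y} {z} (≈⇒≋ x≈y) (≈⇒≋ y≈z) = ≈⇒≋
    (null-resp (λ n → telescope (seq x n) (seq y n) (seq z n)) (null-+ x≈y y≈z))

  -- Opaque copies of the operations, so that compound terms are never compared
  -- through the Cauchy proofs contained in _+_, _*_ and -_.
  infixl 6 _+ʳ_
  infixl 7 _*ʳ_
  infix  8 -ʳ_
  opaque
    _+ʳ_ _*ʳ_ : ℝ → ℝ → ℝ
    x +ʳ y = x + y
    x *ʳ y = x * y

    -ʳ_ : ℝ → ℝ
    -ʳ x = - x

  opaque
    unfolding _+ʳ_ _*ʳ_ -ʳ_

    +ʳ≡+ : ∀ x y → x +ʳ y ≡ x + y
    +ʳ≡+ x y = refl

    *ʳ≡* : ∀ x y → x *ʳ y ≡ x * y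
    *ʳ≡* x y = refl

    -ʳ≡- : ∀ x y → x +ʳ -ʳ y ≡ x - y
    -ʳ≡- x y = refl

    +-cong : ∀ {x y u v} → x ≋ y → u ≋ v → x +ʳ u ≋ y +ʳ v
    +-cong {x} {y} {u} {v} (≈⇒≋ x≈y) (≈⇒≋ u≈v) = ≈⇒≋ (null-resp
      (λ n → sym (+-difference (seq x n) (seq u n) (seq y n) (seq v n))) (null-+ x≈y u≈v))

    -‿cong : ∀ {x y} → x ≋ y → -ʳ x ≋ -ʳ y
    -‿cong {x} {y} (≈⇒≋ x≈y) = ≈⇒≋
      (null-resp (λ n → ℚₚ.neg-distrib-+ (seq x n) (ℚ.- seq y n)) (null-neg x≈y))

    *-cong : ∀ {x y u v} → x ≋ y → u ≋ v → x *ʳ u ≋ y *ʳ v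
    *-cong {x} {y} {u} {v} (≈⇒≋ x≈y) (≈⇒≋ u≈v) = ≈⇒≋ (null-resp
      (λ n → trans
        (cong (seq x n ℚ.* (seq u n ℚ.- seq v n) ℚ.+_) (ℚₚ.*-comm (seq v n) (seq x n ℚ.- seq y n)))
        (sym (*-difference (seq x n) (seq u n) (seq y n) (seq v n))))
      (null-+ {λ n → seq x n ℚ.* (seq u n ℚ.- seq v n)} {λ n → seq v n ℚ.* (seq x n ℚ.- seq y n)}
        (null-* {seq x} (cauchy x) u≈v) (null-* {seq v} (cauchy v) x≈y)))

    ℝ-isCommutativeRing : IsCommutativeRing _≋_ _+ʳ_ _*ʳ_ -ʳ_ 0ℝ 1ℝ
    ℝ-isCommutativeRing = record
      { isRing = record
        { +-isAbelianGroup = record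
          { isGroup = record
            { isMonoid = record
              { isSemigroup = record
                { isMagma = record
                  { isEquivalence = record
                    { refl = pointwise λ _ → refl ; sym = ≋-sym ; trans = ≋-trans }
                  ; ∙-cong = +-cong }
                ; assoc = λ x y z → pointwise λ n → ℚₚ.+-assoc (seq x n) (seq y n) (seq z n) }
              ; identity = (λ x → pointwise λ n → ℚₚ.+-identityˡ (seq x n))
                         , (λ x → pointwise λ n → ℚₚ.+-identityʳ (seq x n)) }
            ; inverse = (λ x → pointwise λ n → ℚₚ.+-inverseˡ (seq x n))
                      , (λ x → pointwise λ n → ℚₚ.+-inverseʳ (seq x n))
            ; ⁻¹-cong = -‿cong }
          ; comm = λ x y → pointwise λ n → ℚₚ.+-comm (seq x n) (seq y n) }
        ; *-cong = *-cong
        ; *-assoc = λ x y z → pointwise λ n → ℚₚ.*-assoc (seq x n) (seq y n) (seq z n)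
        ; *-identity = (λ x → pointwise λ n → ℚₚ.*-identityˡ (seq x n))
                     , (λ x → pointwise λ n → ℚₚ.*-identityʳ (seq x n))
        ; distrib = (λ x y z → pointwise λ n → ℚₚ.*-distribˡ-+ (seq x n) (seq y n) (seq z n))
                  , (λ x y z → pointwise λ n → ℚₚ.*-distribʳ-+ (seq x n) (seq y n) (seq z n)) }
      ; *-comm = λ x y → pointwise λ n → ℚₚ.*-comm (seq x n) (seq y n) }

    *≋*ʳ : ∀ {x y u v} → x ≋ u → y ≋ v → x * y ≋ u *ʳ v
    *≋*ʳ = *-cong

  ℝ-commutativeRing : CommutativeRing 0ℓ 0ℓ
  ℝ-commutativeRing = record { isCommutativeRing = ℝ-isCommutativeRing }

  -- Denominator 1 is given directly instead of by `i ℚ./ 1`, whose normalisation is stuck on a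
  -- variable `i`.
  fromℤ : ℤ → ℝ
  fromℤ i = fromℚ (ℚ.mkℚ i 0 (Coprimality.sym (Coprimality.1-coprimeTo _)))

  /1 : ∀ i → i ℚ./ 1 ≡ seq (fromℤ i) 0
  /1 i = ℚₚ.↥p/↧p≡p (seq (fromℤ i) 0)

  opaque
    unfolding _+ʳ_ _*ʳ_ -ʳ_

    fromℤ-+ : ∀ i j → fromℤ (i ℤ.+ j) ≋ fromℤ i +ʳ fromℤ j
    fromℤ-+ i j = pointwise λ _ → sym (trans
      (cong (ℚ._/ 1) (cong₂ ℤ._+_ (ℤₚ.*-identityʳ i) (ℤₚ.*-identityʳ j))) (/1 (i ℤ.+ j)))

    fromℤ-* : ∀ i j → fromℤ (i ℤ.* j) ≋ fromℤ i *ʳ fromℤ j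
    fromℤ-* i j = pointwise λ _ → sym (/1 (i ℤ.* j))

    fromℤ-neg : ∀ i → fromℤ (ℤ.- i) ≋ -ʳ fromℤ i
    fromℤ-neg (+ 0)      = pointwise λ _ → refl
    fromℤ-neg (+ suc n)  = pointwise λ _ → refl
    fromℤ-neg ℤ.-[1+ n ] = pointwise λ _ → refl

  ℤ→ℝ : CommutativeRing.rawRing ℤₚ.+-*-commutativeRing
          -Raw-AlmostCommutative⟶ fromCommutativeRing ℝ-commutativeRing
  ℤ→ℝ = record
    { ⟦_⟧    = fromℤ
    ; +-homo = fromℤ-+
    ; *-homo = fromℤ-*
    ; -‿homo = fromℤ-neg
    ; 0-homo = pointwise λ _ → refl
    ; 1-homo = pointwise λ _ → refl
    }

  NonNegSeq Negative : (ℕ → ℚ) → Set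
  NonNegSeq s = ∀ ε → 0ℚ ℚ.< ε → Eventually λ n → 0ℚ ℚ.< s n ℚ.+ ε
  Negative s = ∃ λ ε → 0ℚ ℚ.< ε × Eventually λ n → s n ℚ.+ ε ℚ.< 0ℚ

  nonNegSeq-resp : ∀ {s t} → Null (λ n → s n ℚ.- t n) → NonNegSeq s → NonNegSeq t
  nonNegSeq-resp {s} {t} null s≥0 ε 0<ε = eventually₂
    (λ n s<t+ 0<s+ → subst (0ℚ ℚ.<_)
      (solve 3 (λ s t ε → (con ½ :* ε :- (s :- t)) :+ (s :+ con ½ :* ε) := t :+ ε) refl (s n) (t n) ε)
      (ℚₚ.+-mono-< (∣p∣<ε⇒0<ε-p s<t+) 0<s+))
    (null (½ ℚ.* ε) (half-pos 0<ε)) (s≥0 (½ ℚ.* ε) (half-pos 0<ε))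

  nonNegSeq-+ : ∀ {s t} → NonNegSeq s → NonNegSeq t → NonNegSeq (λ n → s n ℚ.+ t n)
  nonNegSeq-+ {s} {t} s≥0 t≥0 ε 0<ε = eventually₂
    (λ n hs ht → subst (0ℚ ℚ.<_)
      (solve 3 (λ s t ε → (s :+ con ½ :* ε) :+ (t :+ con ½ :* ε) := (s :+ t) :+ ε) refl (s n) (t n) ε)
      (ℚₚ.+-mono-< hs ht))
    (s≥0 (½ ℚ.* ε) (half-pos 0<ε)) (t≥0 (½ ℚ.* ε) (half-pos 0<ε))

  product-lower : ∀ {p q B δ} → 0ℚ ℚ.≤ p → ℚ.∣ p ∣ ℚ.≤ B → 0ℚ ℚ.< δ → 0ℚ ℚ.< q ℚ.+ δ →
    0ℚ ℚ.≤ p ℚ.* q ℚ.+ B ℚ.* δ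
  product-lower {p} {q} {B} {δ} 0≤p p≤B 0<δ 0<q+δ = subst (0ℚ ℚ.≤_)
    (solve 4 (λ p q B δ → p :* (q :+ δ) :+ (B :- p) :* δ := p :* q :+ B :* δ) refl p q B δ)
    (ℚₚ.+-mono-≤ (0≤* 0≤p (ℚₚ.<⇒≤ 0<q+δ))
      (0≤* (0≤q-p (ℚₚ.≤-trans (p≤∣p∣ p) p≤B)) (ℚₚ.<⇒≤ 0<δ)))

  -- At each index the signs of the two rationals are decided. If one is non-negative, the product
  -- is below 0 by at most its bound times the error of the other; if neither is positive, the
  -- product is non-negative.
  nonNegSeq-* : ∀ {s t} → IsCauchy s → IsCauchy t →
    NonNegSeq s → NonNegSeq t → NonNegSeq (λ n → s n ℚ.* t n)
  nonNegSeq-* {s} {t} s-cauchy t-cauchy s≥0 t≥0 ε 0<ε =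
    let B , B>0 , s≤B = bounded s s-cauchy
        C , C>0 , t≤C = bounded t t-cauchy
        δ , 0<δ , Bδ≡ = shrink B B>0 ε 0<ε
        γ , 0<γ , Cγ≡ = shrink C C>0 ε 0<ε
    in eventually₂
      (λ n (s≤B , 0<t+δ) (t≤C , 0<s+γ) → combine (s n) (t n) s≤B 0<δ 0<t+δ Bδ≡ t≤C 0<γ 0<s+γ Cγ≡)
      (eventually₂ (λ _ → _,_) s≤B (t≥0 δ 0<δ)) (eventually₂ (λ _ → _,_) t≤C (s≥0 γ 0<γ))
    where
    half : ∀ p → 0ℚ ℚ.≤ p ℚ.+ ½ ℚ.* ε → 0ℚ ℚ.< p ℚ.+ ε
    half p h = subst (0ℚ ℚ.<_)
      (solve 2 (λ p ε → (p :+ con ½ :* ε) :+ con ½ :* ε := p :+ ε) refl p ε)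
      (ℚₚ.+-mono-≤-< h (half-pos 0<ε))
    combine : ∀ p q {B C δ γ} → ℚ.∣ p ∣ ℚ.≤ B → 0ℚ ℚ.< δ → 0ℚ ℚ.< q ℚ.+ δ → B ℚ.* δ ≡ ½ ℚ.* ε →
      ℚ.∣ q ∣ ℚ.≤ C → 0ℚ ℚ.< γ → 0ℚ ℚ.< p ℚ.+ γ → C ℚ.* γ ≡ ½ ℚ.* ε → 0ℚ ℚ.< p ℚ.* q ℚ.+ ε
    combine p q p≤B 0<δ 0<q+δ Bδ≡ q≤C 0<γ 0<p+γ Cγ≡ with ℚₚ.≤-total 0ℚ p | ℚₚ.≤-total 0ℚ q
    ... | inj₁ 0≤p | _ = half (p ℚ.* q) (subst (λ d → 0ℚ ℚ.≤ p ℚ.* q ℚ.+ d) Bδ≡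
      (product-lower 0≤p p≤B 0<δ 0<q+δ))
    ... | inj₂ _ | inj₁ 0≤q = half (p ℚ.* q) (subst₂ (λ e d → 0ℚ ℚ.≤ e ℚ.+ d) (ℚₚ.*-comm q p) Cγ≡
      (product-lower 0≤q q≤C 0<γ 0<p+γ))
    ... | inj₂ p≤0 | inj₂ q≤0 = subst (0ℚ ℚ.<_)
      (solve 3 (λ p q ε → (con 0ℚ :- p) :* (con 0ℚ :- q) :+ ε := p :* q :+ ε) refl p q ε)
      (ℚₚ.+-mono-≤-< (0≤* (0≤q-p p≤0) (0≤q-p q≤0)) 0<ε)

  -- From some `N` on the sequence stays within `δ = ε/4` of `s N`, and one rational comparison
  -- decides: `s N > - 3δ` keeps later terms above `- ε`, and otherwise they stay below `- δ`.
  ¬negative⇒nonNegSeq : ∀ {s} → IsCauchy s → ¬ Negative s → NonNegSeq s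
  ¬negative⇒nonNegSeq {s} s-cauchy ¬neg ε 0<ε = at (s-cauchy δ 0<δ)
    where
    δ = ½ ℚ.* (½ ℚ.* ε)
    0<δ : 0ℚ ℚ.< δ
    0<δ = half-pos (half-pos 0<ε)
    at : (∃ λ N → ∀ m n → N ℕ.≤ m → N ℕ.≤ n → ℚ.∣ s m ℚ.- s n ∣ ℚ.< δ) →
      Eventually λ n → 0ℚ ℚ.< s n ℚ.+ ε
    at (N , close) with 0ℚ ℚₚ.<? s N ℚ.+ (δ ℚ.+ δ ℚ.+ δ)
    ... | yes h = N , λ n N≤n → subst (0ℚ ℚ.<_)
      (solve 3 (λ t s ε → let d = con ½ :* (con ½ :* ε) in
        (t :+ (d :+ d :+ d)) :+ (d :- (t :- s)) := s :+ ε) refl (s N) (s n) ε)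
      (ℚₚ.+-mono-< h (∣p∣<ε⇒0<ε-p (close N n ℕₚ.≤-refl N≤n)))
    ... | no h = contradiction (δ , 0<δ , N , λ n N≤n → ℚₚ.<-≤-trans
      (0<q-p⁻¹ (subst (0ℚ ℚ.<_)
        (solve 3 (λ t s d → (d :- (s :- t)) :+ d := (t :+ (d :+ d :+ d)) :- (s :+ d)) refl (s N) (s n) δ)
        (ℚₚ.+-mono-< (∣p∣<ε⇒0<ε-p (close n N N≤n ℕₚ.≤-refl)) 0<δ)))
      (ℚₚ.≮⇒≥ h)) ¬neg

  negative⇒¬nonNegSeq : ∀ {s} → Negative s → ¬ NonNegSeq s
  negative⇒¬nonNegSeq (ε , 0<ε , neg) s≥0 =
    let N , h = eventually₂ (λ _ → ℚₚ.<-asym) neg (s≥0 ε 0<ε) in h N ℕₚ.≤-refl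

  negative⇒nonNegSeq-neg : ∀ {s} → Negative s → NonNegSeq (λ n → ℚ.- s n)
  negative⇒nonNegSeq-neg {s} (ε , 0<ε , neg) δ 0<δ = eventually
    (λ n h → subst (0ℚ ℚ.<_)
      (solve 3 (λ s ε δ → (con 0ℚ :- (s :+ ε)) :+ (ε :+ δ) := :- s :+ δ) refl (s n) ε δ)
      (ℚₚ.+-mono-< (0<q-p h) (ℚₚ.+-mono-< 0<ε 0<δ)))
    neg

  negative-* : ∀ {s t : ℕ → ℚ} → Negative (λ n → ℚ.- s n) → Negative t → Negative (λ n → s n ℚ.* t n)
  negative-* {s} {t} (ε , 0<ε , hs) (δ , 0<δ , ht) = ε ℚ.* δ , 0<* 0<ε 0<δ , eventually₂
    (λ n s>ε t<-δ → 0<q-p⁻¹ (subst (0ℚ ℚ.<_)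
      (solve 4 (λ s t ε δ →
        (con 0ℚ :- (:- s :+ ε)) :* (con 0ℚ :- (t :+ δ)) :+
          (ε :* (con 0ℚ :- (t :+ δ)) :+ (con 0ℚ :- (:- s :+ ε)) :* δ) :=
        con 0ℚ :- (s :* t :+ ε :* δ)) refl (s n) (t n) ε δ)
      (ℚₚ.+-mono-< (0<* (0<q-p s>ε) (0<q-p t<-δ))
        (ℚₚ.+-mono-< (0<* 0<ε (0<q-p t<-δ)) (0<* (0<q-p s>ε) 0<δ)))))
    hs ht

  opaque
    unfolding _+ʳ_ _*ʳ_ -ʳ_

    nonNeg-resp : ∀ {x y} → x ≋ y → NonNegative x → NonNegative y
    nonNeg-resp {x} {y} (≈⇒≋ x≈y) (0≤⇒nonNeg x≥0) = 0≤⇒nonNeg (nonNegSeq-resp {seq x} {seq y} x≈y x≥0)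

    nonNeg-+ : ∀ {x y} → NonNegative x → NonNegative y → NonNegative (x +ʳ y)
    nonNeg-+ {x} {y} (0≤⇒nonNeg x≥0) (0≤⇒nonNeg y≥0) =
      0≤⇒nonNeg (nonNegSeq-+ {seq x} {seq y} x≥0 y≥0)

    nonNeg-* : ∀ {x y} → NonNegative x → NonNegative y → NonNegative (x *ʳ y)
    nonNeg-* {x} {y} (0≤⇒nonNeg x≥0) (0≤⇒nonNeg y≥0) =
      0≤⇒nonNeg (nonNegSeq-* {seq x} {seq y} (cauchy x) (cauchy y) x≥0 y≥0)

    ¬negative⇒nonNeg : ∀ {x} → ¬ Negative (seq x) → NonNegative x
    ¬negative⇒nonNeg {x} ¬neg = 0≤⇒nonNeg (¬negative⇒nonNegSeq {seq x} (cauchy x) ¬neg)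

    negative⇒¬nonNeg : ∀ {x} → Negative (seq x) → ¬ NonNegative x
    negative⇒¬nonNeg {x} neg (0≤⇒nonNeg x≥0) = negative⇒¬nonNegSeq {seq x} neg x≥0

    -- `NonNegative` is equivalent to the negation of `Negative`, and negations are stable.
    nonNeg-stable : ∀ {x} → Stable (NonNegative x)
    nonNeg-stable ¬¬x≥0 = ¬negative⇒nonNeg λ neg → ¬¬x≥0 (negative⇒¬nonNeg neg)

    nonNeg-total : ∀ x → ¬ ¬ (NonNegative x ⊎ NonNegative (-ʳ x))
    nonNeg-total x k = k (inj₁ (¬negative⇒nonNeg λ neg →
      k (inj₂ (0≤⇒nonNeg (negative⇒nonNegSeq-neg {seq x} neg)))))

    -- A negative `x` would make `c x` negative. Positivity of `c` is itself a negation, hence the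
    -- nested appeal to `¬negative⇒nonNeg`.
    nonNeg-cancel : ∀ {c x} → ¬ NonNegative (-ʳ c) → NonNegative (c *ʳ x) → NonNegative x
    nonNeg-cancel {c} {x} c>0 cx≥0 = ¬negative⇒nonNeg λ x<0 → c>0 (¬negative⇒nonNeg λ -c<0 →
      negative⇒¬nonNeg (negative-* {seq c} {seq x} -c<0 x<0) cx≥0)

    nonNeg-const : ∀ {q} → 0ℚ ℚ.≤ q → NonNegative (fromℚ q)
    nonNeg-const {q} 0≤q = 0≤⇒nonNeg λ ε 0<ε → 0 , λ _ _ → ℚₚ.+-mono-≤-< 0≤q 0<ε

    0<⇒¬nonNeg-neg : ∀ {x} → 0ℝ < x → ¬ NonNegative (-ʳ x)
    0<⇒¬nonNeg-neg {x} (ε , 0<ε , x>ε) = negative⇒¬nonNeg (ε , 0<ε , eventually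
      (λ n h → subst (ℚ._< 0ℚ)
        (solve 2 (λ x ε → :- (x :- (con 0ℚ :+ ε)) := :- x :+ ε) refl (seq x n) ε)
        (ℚₚ.neg-antimono-< (0<q-p h)))
      x>ε)

    0<⇒nonNeg : ∀ {x} → 0ℝ < x → NonNegative x
    0<⇒nonNeg {x} 0<x = nonNeg-stable λ ¬x≥0 → nonNeg-total x λ
      { (inj₁ x≥0) → ¬x≥0 x≥0 ; (inj₂ x≤0) → 0<⇒¬nonNeg-neg 0<x x≤0 }

    0<-const : ∀ {q} → 0ℚ ℚ.< q → 0ℝ < fromℚ q
    0<-const {q} 0<q = ½ ℚ.* q , half-pos 0<q , 0 , λ _ _ →
      subst (0ℚ ℚ.+ ½ ℚ.* q ℚ.<_) (half+half q) (ℚₚ.+-monoˡ-< (½ ℚ.* q) (half-pos 0<q))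

  nonNeg-fromℤ : ∀ n → NonNegative (fromℤ (+ n))
  nonNeg-fromℤ n = nonNeg-const (ℚₚ.nonNegative⁻¹ (seq (fromℤ (+ n)) 0))

  pos-fromℤ : ∀ n → ¬ NonNegative (-ʳ fromℤ (+ suc n))
  pos-fromℤ n = 0<⇒¬nonNeg-neg (0<-const (ℚₚ.positive⁻¹ (seq (fromℤ (+ suc n)) 0)))

  ℝ-ordered : OrderedRing
  ℝ-ordered = record
    { commutativeRing = ℝ-commutativeRing
    ; morphism        = ℤ→ℝ
    ; NonNeg          = NonNegative
    ; nonNeg-resp     = λ {x} {y} → nonNeg-resp {x} {y}
    ; nonNeg-+        = λ {x} {y} → nonNeg-+ {x} {y}
    ; nonNeg-*        = λ {x} {y} → nonNeg-* {x} {y}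
    ; nonNeg-ι        = nonNeg-fromℤ
    ; stable          = λ {x} → nonNeg-stable {x}
    ; total           = nonNeg-total
    ; pos-ι           = pos-fromℤ
    ; cancel          = λ {c} {x} → nonNeg-cancel {c} {x}
    }

  opaque
    unfolding _+ʳ_ _*ʳ_ -ʳ_

    ≤⇒nonNeg : ∀ {x y} → x ≤ y → NonNegative (y +ʳ -ʳ x)
    ≤⇒nonNeg {x} {y} x≤y = 0≤⇒nonNeg λ ε 0<ε → eventually
      (λ n h → subst (0ℚ ℚ.<_)
        (solve 3 (λ x y ε → (y :+ ε) :- x := (y :- x) :+ ε) refl (seq x n) (seq y n) ε) (0<q-p h))
      (x≤y ε 0<ε)

    nonNeg⇒≤ : ∀ {x y} → NonNegative (y +ʳ -ʳ x) → x ≤ y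
    nonNeg⇒≤ {x} {y} (0≤⇒nonNeg h) ε 0<ε = eventually
      (λ n h → subst₂ ℚ._<_ (ℚₚ.+-identityˡ (seq x n))
        (solve 3 (λ x y ε → ((y :- x) :+ ε) :+ x := y :+ ε) refl (seq x n) (seq y n) ε)
        (ℚₚ.+-monoˡ-< (seq x n) h))
      (h ε 0<ε)

    3x≤1 : ∀ {x} → x ≤ ⅓ → NonNegative (fromℤ (+ 1) +ʳ -ʳ (fromℤ (+ 3) *ʳ x))
    3x≤1 {x} x≤⅓ = nonNeg-resp
      (pointwise λ n → solve 1
        (λ x → con (seq (fromℤ (+ 3)) 0) :* (con (seq ⅓ 0) :- x) := con 1ℚ :- con (seq (fromℤ (+ 3)) 0) :* x)
        refl (seq x n))
      (nonNeg-* (nonNeg-fromℤ 3) (≤⇒nonNeg {x} {⅓} x≤⅓))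

-- Transfer to the predicates and measures of the theorem.

module _ {n} {U : Pred (Subset n) 0ℓ} (U? : Decidable U) where

  member : ∀ {x} → does (U? x) ≡ true → U x
  member {x} h with yes Ux ← U? x = Ux

  isStar⇒≐star : ∀ {ℓ} → IsStar ℓ (does ∘ U?) → U ≐ star ℓ
  isStar⇒≐star {ℓ} s =
    (λ {x} Ux → lookup⇒[]= ℓ x (trans (sym (s x)) (dec-true (U? x) Ux))) ,
    (λ {x} ℓ∈x → member (trans (s x) ([]=⇒lookup ℓ∈x)))

  ≐star⇒isStar : ∀ {ℓ} → U ≐ star ℓ → IsStar ℓ (does ∘ U?)
  ≐star⇒isStar {ℓ} (U⊆ , ⊆U) = ⊑-antisym
    (λ x h → []=⇒lookup (U⊆ (member h)))
    (λ x h → dec-true (U? x) (⊆U (lookup⇒[]= ℓ x h)))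

-- Exchanges the opaque ring operations for the original ones inside a fold.
foldr-≗ : ∀ {A B : Set} {_∙_ _⋆_ : B → B → B} → (∀ x y → x ∙ y ≡ x ⋆ y) →
  ∀ {f g : A → B} → (∀ a → f a ≡ g a) → ∀ e xs →
  foldr (λ a s → f a ∙ s) e xs ≡ foldr (λ a s → g a ⋆ s) e xs
foldr-≗ ∙≗⋆ f≗g e []       = refl
foldr-≗ {_∙_ = _∙_} ∙≗⋆ f≗g e (x ∷ xs) =
  trans (cong₂ _∙_ (f≗g x) (foldr-≗ ∙≗⋆ f≗g e xs)) (∙≗⋆ _ _)

module Bridge where
  open Reals
  open MeasureAsSum ℝ-ordered using (sum; product; weight; sum-weight)
  open Measure ℝ-ordered using (measure)

  product≡∏ : ∀ {A : Set} (xs : List A) {f g} → (∀ x → f x ≡ g x) → product xs f ≡ ∏ xs g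
  product≡∏ xs {f} {g} f≗g = foldr-≗ {_∙_ = _*ʳ_} {_⋆_ = _*_} *ʳ≡* {f} {g} f≗g 1ℝ xs

  sum≡∑ : ∀ {A : Set} (xs : List A) {f g} → (∀ x → f x ≡ g x) → sum xs f ≡ ∑ xs g
  sum≡∑ xs {f} {g} f≗g = foldr-≗ {_∙_ = _+ʳ_} {_⋆_ = _+_} +ʳ≡+ {f} {g} f≗g 0ℝ xs

  mass : ∀ {n} → Vector ℝ n → Subset n → ℝ
  mass p x = (∏[ ℓ ← elements x ] p ℓ) * (∏[ k ← elements (∁ x) ] (1ℝ - p k))

  weight≡mass : ∀ {n} (p : Vector ℝ n) x → weight p x ≡ mass p x
  weight≡mass p x = trans
    (cong₂ _*ʳ_ (product≡∏ (elements x) {p} {p} λ _ → refl)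
      (product≡∏ (elements (∁ x)) {λ k → 1ℝ +ʳ -ʳ p k} {λ k → 1ℝ - p k} λ k → -ʳ≡- 1ℝ (p k)))
    (*ʳ≡* (∏ (elements x) p) (∏ (elements (∁ x)) (λ k → 1ℝ - p k)))

  μ≋measure : ∀ {n} (p : Vector ℝ n) {U : Pred (Subset n) 0ℓ} (U? : Decidable U) →
    μ p U? ≋ measure p (does ∘ U?)
  μ≋measure {n} p U? = subst (_≋ measure p (does ∘ U?))
    (sum≡∑ (filter U? (allSubsets n)) {weight p} {mass p} (weight≡mass p)) (sum-weight p U?)

open Reals
open Bridge
open Certificates ℝ-ordered
open Measure ℝ-ordered
open CrossIntersection ℝ-ordered

theorem3 : ∀ (m : ℕ) → let n = suc m in
  (p₁ p₂ : Vector ℝ n) →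
  IsProbabilityVector p₁ → IsProbabilityVector p₂ →
  IsMaximum (p₁ zero * p₂ zero) (λ ℓ → p₁ ℓ * p₂ ℓ) →
  (∀ ℓ → p₁ ℓ ≤ ⅓ × p₂ ℓ ≤ ⅓) →
  (U₁ U₂ : Pred (Subset n) 0ℓ) (U₁? : Decidable U₁) (U₂? : Decidable U₂) →
  CrossIntersecting U₁ U₂ →
  (μ p₁ U₁? * μ p₂ U₂? ≤ p₁ zero * p₂ zero)
  × (μ p₁ U₁? * μ p₂ U₂? ≈ p₁ zero * p₂ zero
  ⇔ (∃ λ (ℓ : Fin n) → p₁ ℓ * p₂ ℓ ≈ p₁ zero * p₂ zero × U₁ ≐ star ℓ × U₂ ≐ star ℓ))
theorem3 m p₁ p₂ p₁-prob p₂-prob (_ , p₁p₂≤P) ≤⅓ U₁ U₂ U₁? U₂? cross =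
  attained (μ p₁ U₁?) (μ p₂ U₂?) (μ≋measure p₁ U₁?) (μ≋measure p₂ U₂?)
  where
  f g : Subset (suc m) → Bool
  f = does ∘ U₁?
  g = does ∘ U₂?
  P : ℝ
  P = p₁ zero * p₂ zero

  small : ∀ {p : Vector ℝ (suc m)} → IsProbabilityVector p → (∀ ℓ → p ℓ ≤ ⅓) → IsSmall p
  small p-prob p≤⅓ ℓ =
    0<⇒¬nonNeg-neg (proj₁ (p-prob ℓ)) , 0<⇒nonNeg (proj₁ (p-prob ℓ)) , 3x≤1 (p≤⅓ ℓ)
  small₁ : IsSmall p₁
  small₁ = small p₁-prob (proj₁ ∘ ≤⅓)
  small₂ : IsSmall p₂
  small₂ = small p₂-prob (proj₂ ∘ ≤⅓)

  P-maximal : ∀ ℓ → NonNegative (p₁ zero *ʳ p₂ zero +ʳ -ʳ (p₁ ℓ *ʳ p₂ ℓ))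
  P-maximal ℓ = ≤⇒nonNeg (subst₂ _≤_ (sym (*ʳ≡* (p₁ ℓ) (p₂ ℓ))) (sym (*ʳ≡* (p₁ zero) (p₂ zero))) (p₁p₂≤P ℓ))
  fg-cross : Cross f g
  fg-cross x y fx gy = cross x y (member U₁? fx) (member U₂? gy)

  P≋ : P ≋ p₁ zero *ʳ p₂ zero
  P≋ = *≋*ʳ {p₁ zero} {p₂ zero} Eq.refl Eq.refl

  -- u and v stand for the two measures: as variables they are not unfolded.
  attained : ∀ u v → u ≋ measure p₁ f → v ≋ measure p₂ g →
    (u * v ≤ P) × (u * v ≈ P ⇔ (∃ λ ℓ → p₁ ℓ * p₂ ℓ ≈ P × U₁ ≐ star ℓ × U₂ ≐ star ℓ))
  attained u v u≋ v≋ = inequality , mk⇔ forward backward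
    where
    uv≋ : u * v ≋ measure p₁ f *ʳ measure p₂ g
    uv≋ = *≋*ʳ {u} {v} u≋ v≋

    inequality : u * v ≤ P
    inequality = nonNeg⇒≤ (nonNeg-resp
      (Eq.+-cong (Eq.sym P≋) (Eq.-‿cong (Eq.sym uv≋)))
      (cross-product-bound small₁ small₂ P-maximal fg-cross))

    value : ∀ ℓ → IsStar ℓ f → IsStar ℓ g → p₁ ℓ * p₂ ℓ ≋ u * v
    value ℓ f-star g-star = Eq.trans
      (*≋*ʳ {p₁ ℓ} {p₂ ℓ} (Eq.sym (measure-star p₁ ℓ f-star)) (Eq.sym (measure-star p₂ ℓ g-star)))
      (Eq.sym uv≋)

    forward : u * v ≈ P → ∃ λ ℓ → p₁ ℓ * p₂ ℓ ≈ P × U₁ ≐ star ℓ × U₂ ≐ star ℓ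
    forward uv≈P =
      -- There are finitely many candidates `ℓ` and `IsStar` is decidable, so a witness can be
      -- extracted from its double negation.
      let ℓ , f-star , g-star = decidable-stable
            (any? λ ℓ → isStar? ℓ f ×-dec isStar? ℓ g)
            (cross-equality small₁ small₂ P-maximal fg-cross
              (Eq.trans (Eq.sym uv≋) (Eq.trans uv≋P P≋)))
      -- Stars at `ℓ` have measures `p₁ ℓ` and `p₂ ℓ`, so attaining `P` puts `ℓ` among the maximal
      -- coordinates.
      in ℓ , ≋⇒≈ (Eq.trans (value ℓ f-star g-star) uv≋P)
           , isStar⇒≐star U₁? f-star , isStar⇒≐star U₂? g-star
      where
      uv≋P : u * v ≋ P
      uv≋P = ≈⇒≋ uv≈P

    backward : (∃ λ ℓ → p₁ ℓ * p₂ ℓ ≈ P × U₁ ≐ star ℓ × U₂ ≐ star ℓ) → u * v ≈ P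
    backward (ℓ , p≈P , U₁≐ , U₂≐) = ≋⇒≈ (Eq.trans
      (Eq.sym (value ℓ (≐star⇒isStar U₁? U₁≐) (≐star⇒isStar U₂? U₂≐))) p≋P)
      where
      p≋P : p₁ ℓ * p₂ ℓ ≋ P
      p≋P = ≈⇒≋ p≈P
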